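{- RED-BLUE SEPARATION (minimization version) has a polynomial-time $(2\ln n)$-factor approximation algorithm, where $n$ is the order of the input graph. That is, there is a polynomial-time algorithm which, given a red-blue colored twin-free graph $(G,c)$ of order $n$, outputs a red-blue separating set of $(G,c)$ of size at most $2\ln n\cdot \mathrm{sep}_{RB}(G,c)$.
   Context: All graphs are finite, simple and undirected. $N[x]$ denotes the closed neighborhood of $x$. A graph is twin-free if no two distinct vertices have the same closed neighborhood. A red-blue coloring of $G$ is a map $c:V(G)\to\{\text{red},\text{blue}\}$. A red-blue separating set of $(G,c)$ is a set $S\subseteq V(G)$ such that $N[r]\cap S\neq N[b]\cap S$ for every red vertex $r$ and every blue vertex $b$. For $G$ twin-free, $\mathrm{sep}_{RB}(G,c)$ is the smallest size of a red-blue separating set of $(G,c)$. The minimization version of RED-BLUE SEPARATION asks, given a red-blue colored twin-free graph $(G,c)$, for a smallest red-blue separating set. -}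

module Defs where

open import Data.Bool.Base using (Bool; true; false; _∨_; if_then_else_)
import Data.Bool.Properties as Bool
open import Data.Fin.Base using (Fin; toℕ)
import Data.Fin.Properties as Fin
open import Data.Fin.Subset using (Subset; ⊤; _∩_; ∣_∣)
import Data.Fin.Subset.Properties as Subset
import Data.Integer.Base as ℤ
open import Data.List.Base as List using (List; []; _∷_; _++_; length)
open import Data.Nat.Base using (ℕ; zero; suc; _+_; _*_; _∸_; _≤_; _≡ᵇ_; z≤n; s≤s)
import Data.Nat.Properties as ℕ
open import Data.Product.Base using (∃; _×_; _,_; proj₁; proj₂)
open import Data.Rational.Base as ℚ using (ℚ; 0ℚ; 1ℚ)
open import Data.Vec.Base as Vec using (tabulate)
import Data.Vec.Properties as Vec
open import Level using (0ℓ)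
open import Relation.Binary.Definitions using (DecidableEquality)
open import Relation.Binary.PropositionalEquality using (_≡_; _≢_; refl; sym; trans)
open import Relation.Nullary.Decidable using (yes; no; ⌊_⌋; _×-dec_; _→-dec_; ¬?)
open import Relation.Nullary.Negation using (contradiction)
open import Relation.Unary using (Pred; Decidable)

record Graph (n : ℕ) : Set where
  field
    adj         : Fin n → Fin n → Bool
    adj-sym     : ∀ x y → adj x y ≡ adj y x
    adj-irrefl  : ∀ x → adj x x ≡ false

open Graph public

N[_,_] : ∀ {n} → Graph n → Fin n → Subset n
N[ G , x ] = tabulate λ y → ⌊ x Fin.≟ y ⌋ ∨ adj G x y

TwinFree : ∀ {n} → Graph n → Set
TwinFree G = ∀ x y → x ≢ y → N[ G , x ] ≢ N[ G , y ]

data Colour : Set where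
  red blue : Colour

Colouring : ℕ → Set
Colouring n = Fin n → Colour

RedBlueSeparating : ∀ {n} → Graph n → Colouring n → Subset n → Set
RedBlueSeparating G c S =
  ∀ r b → c r ≡ red → c b ≡ blue → N[ G , r ] ∩ S ≢ N[ G , b ] ∩ S

IsLeast : Pred ℕ 0ℓ → ℕ → Set
IsLeast P m = P m × (∀ k → P k → m ≤ k)

least : ∀ {P : Pred ℕ 0ℓ} → Decidable P → ∀ k → P k → ∃ (IsLeast P)
least P? zero p = zero , p , λ _ _ → z≤n
least {P} P? (suc k) p with P? zero
... | yes p₀ = zero , p₀ , λ _ _ → z≤n
... | no ¬p₀ with least (λ j → P? (suc j)) k p
...   | m , pm , m≤ = suc m , pm , bound
  where
  bound : ∀ j → P j → suc m ≤ j
  bound zero    pj = contradiction pj ¬p₀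
  bound (suc j) pj = s≤s (m≤ j pj)

HasSeparatingSetOfSize : ∀ {n} → Graph n → Colouring n → Pred ℕ 0ℓ
HasSeparatingSetOfSize G c k = ∃ λ S → RedBlueSeparating G c S × ∣ S ∣ ≡ k

_≟ᶜ_ : DecidableEquality Colour
red  ≟ᶜ red  = yes refl
red  ≟ᶜ blue = no λ ()
blue ≟ᶜ red  = no λ ()
blue ≟ᶜ blue = yes refl

separating? : ∀ {n} (G : Graph n) (c : Colouring n) → Decidable (RedBlueSeparating G c)
separating? G c S = Fin.all? λ r → Fin.all? λ b →
  (c r ≟ᶜ red) →-dec ((c b ≟ᶜ blue) →-dec
    ¬? (Vec.≡-dec Bool._≟_ (N[ G , r ] ∩ S) (N[ G , b ] ∩ S)))

⊤-separating : ∀ {n} (G : Graph n) (c : Colouring n) → TwinFree G → RedBlueSeparating G c ⊤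
⊤-separating G c tf r b cr cb eq = tf r b r≢b
  (trans (sym (Subset.∩-identityʳ _)) (trans eq (Subset.∩-identityʳ _)))
  where
  r≢b : r ≢ b
  r≢b refl with trans (sym cr) cb
  ... | ()

smallestSeparating : ∀ {n} (G : Graph n) (c : Colouring n) → TwinFree G →
                     ∃ (IsLeast (HasSeparatingSetOfSize G c))
smallestSeparating {n} G c tf =
  least (λ k → Subset.anySubset? λ S → separating? G c S ×-dec (∣ S ∣ ℕ.≟ k))
        ∣ ⊤ {n} ∣ (⊤ , ⊤-separating G c tf , refl)

sepRB : ∀ {n} (G : Graph n) → Colouring n → TwinFree G → ℕ
sepRB G c tf = proj₁ (smallestSeparating G c tf)

-- expTerm q k = qᵏ / k!
expTerm : ℚ → ℕ → ℚ
expTerm q zero    = 1ℚ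
expTerm q (suc k) = expTerm q k ℚ.* (q ℚ.* (ℤ.+ 1 ℚ./ suc k))

expSum : ℚ → ℕ → ℚ
expSum q zero    = 0ℚ
expSum q (suc k) = expSum q k ℚ.+ expTerm q k

ℕ→ℚ : ℕ → ℚ
ℕ→ℚ m = ℤ.+ m ℚ./ 1

infix 4 ln[_]<_ _≤[_·ln_]

-- ln is the inverse of exp.  For n ≥ 1 the real number ln n ≥ 0 is given by
-- its upper Dedekind cut: the rationals q ≥ 0 with n < exp q.  As q ≥ 0, the
-- partial sums increase to exp q, so n < exp q iff some partial sum exceeds n.
ln[_]<_ : ℕ → ℚ → Set
ln[ n ]< q = 0ℚ ℚ.≤ q × ∃ λ k → ℕ→ℚ n ℚ.< expSum q k

-- a ≤ b · ln n: as b ≥ 0 and ln n is the infimum of its upper cut, this is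
-- a ≤ b · q for every q in the cut.
_≤[_·ln_] : ℕ → ℕ → ℕ → Set
a ≤[ b ·ln n ] = ∀ q → ln[ n ]< q → ℕ→ℚ a ℚ.≤ ℕ→ℚ b ℚ.* q

-- A unit-cost RAM with a read-only random-access input, registers, an
-- unbounded work memory, addition and truncated subtraction, in structured
-- form.  There is no multiplication, so the bit length of a computed number
-- grows by at most a constant per step, and polynomial time in this model
-- coincides with polynomial time on Turing machines for inputs whose numbers
-- have bit length polynomial in the length of the list.

data Expr : Set where
  const     : ℕ → Expr
  reg       : ℕ → Expr
  input mem : Expr → Expr
  _⊕_ _⊖_   : Expr → Expr → Expr

data Program : Set where
  skip            : Program
  _:=_            : ℕ → Expr → Program
  mem[_]:=_       : Expr → Expr → Program
  _⨾_             : Program → Program → Program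
  ifnz_then_else_ : Expr → Program → Program → Program
  whilenz_loop_   : Expr → Program → Program

infixl 6 _⊕_ _⊖_
infix  5 _:=_ mem[_]:=_
infixr 4 _⨾_

record State : Set where
  constructor ⟨_,_⟩
  field
    regs   : ℕ → ℕ
    memory : ℕ → ℕ

open State public

initial : State
initial = ⟨ (λ _ → 0) , (λ _ → 0) ⟩

_[_↦_] : (ℕ → ℕ) → ℕ → ℕ → (ℕ → ℕ)
(f [ k ↦ v ]) i = if i ≡ᵇ k then v else f i

_‼_ : List ℕ → ℕ → ℕ
[]       ‼ _     = 0
(x ∷ xs) ‼ zero  = x
(x ∷ xs) ‼ suc i = xs ‼ i

eval : List ℕ → State → Expr → ℕ
eval xs s (const k) = k
eval xs s (reg i)   = regs s i
eval xs s (input e) = xs ‼ eval xs s e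
eval xs s (mem e)   = memory s (eval xs s e)
eval xs s (e ⊕ e′)  = eval xs s e + eval xs s e′
eval xs s (e ⊖ e′)  = eval xs s e ∸ eval xs s e′

cost : Expr → ℕ
cost (const _) = 1
cost (reg _)   = 1
cost (input e) = 1 + cost e
cost (mem e)   = 1 + cost e
cost (e ⊕ e′)  = 1 + cost e + cost e′
cost (e ⊖ e′)  = 1 + cost e + cost e′

-- xs ⊢ p , s ⇓ s′ [ t ]: on input xs and from state s, the program p halts in
-- state s′ after t steps.
infix 3 _⊢_,_⇓_[_]

data _⊢_,_⇓_[_] (xs : List ℕ) : Program → State → State → ℕ → Set where

  skip : ∀ {s} → xs ⊢ skip , s ⇓ s [ 1 ]

  assign : ∀ {s i e} →
    xs ⊢ i := e , s ⇓ ⟨ regs s [ i ↦ eval xs s e ] , memory s ⟩ [ 1 + cost e ]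

  store : ∀ {s e e′} →
    xs ⊢ mem[ e ]:= e′ , s
       ⇓ ⟨ regs s , memory s [ eval xs s e ↦ eval xs s e′ ] ⟩ [ 1 + cost e + cost e′ ]

  seq : ∀ {p p′ s s′ s″ t t′} →
    xs ⊢ p , s ⇓ s′ [ t ] → xs ⊢ p′ , s′ ⇓ s″ [ t′ ] →
    xs ⊢ p ⨾ p′ , s ⇓ s″ [ t + t′ ]

  if-nonzero : ∀ {e p p′ s s′ t} →
    eval xs s e ≢ 0 → xs ⊢ p , s ⇓ s′ [ t ] →
    xs ⊢ ifnz e then p else p′ , s ⇓ s′ [ 1 + cost e + t ]

  if-zero : ∀ {e p p′ s s′ t} →
    eval xs s e ≡ 0 → xs ⊢ p′ , s ⇓ s′ [ t ] →
    xs ⊢ ifnz e then p else p′ , s ⇓ s′ [ 1 + cost e + t ]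

  while-zero : ∀ {e p s} →
    eval xs s e ≡ 0 →
    xs ⊢ whilenz e loop p , s ⇓ s [ 1 + cost e ]

  while-nonzero : ∀ {e p s s′ s″ t t′} →
    eval xs s e ≢ 0 → xs ⊢ p , s ⇓ s′ [ t ] →
    xs ⊢ whilenz e loop p , s′ ⇓ s″ [ t′ ] →
    xs ⊢ whilenz e loop p , s ⇓ s″ [ 1 + cost e + t + t′ ]

infix 3 _on_outputs_inTime_

-- The output ys is left in the memory cells 0, 1, …, length ys - 1.
_on_outputs_inTime_ : Program → List ℕ → List ℕ → ℕ → Set
p on xs outputs ys inTime t = ∃ λ s →
  (xs ⊢ p , initial ⇓ s [ t ]) × (∀ (i : Fin (length ys)) → memory s (toℕ i) ≡ List.lookup ys i)

bit : Bool → ℕ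
bit b = if b then 1 else 0

encodeColour : Colour → ℕ
encodeColour red  = 1
encodeColour blue = 0

encodeInstance : ∀ {n} → Graph n → Colouring n → List ℕ
encodeInstance {n} G c =
  n ∷ List.tabulate (λ x → encodeColour (c x))
    ++ List.concat (List.tabulate λ x → List.tabulate λ y → bit (adj G x y))

encodeSubset : ∀ {n} → Subset n → List ℕ
encodeSubset S = Vec.toList (Vec.map bit S)

module Submission where

-- Greedy set cover.  The elements to cover are the red-blue pairs, and a vertex
-- covers the pairs it separates.  If k is the optimum, some vertex covers at
-- least a k-th of the uncovered pairs, so each round multiplies their number by
-- at most (k - 1) / k.  There are at most n² / 4 pairs, and one is left before
-- the last of g rounds, hence (k / (k - 1))ᵍ⁻¹ ≤ n² / 4.  On the other hand
-- exp (g / 2k) ≤ (2k / (2k - 1))ᵍ, so g > 2k ln n would imply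
-- n² < (k / (k - 1))ᵍ, which contradicts k / (k - 1) ≤ 4 when k ≥ 2.
-- The sums and the maximum of a round are terms with iteration bounded by n,
-- and such terms run in polynomial time on the RAM.

open import Defs
open import Data.Bool.Base as Bool using (Bool; true; false; _∧_; _∨_; _xor_; not)
import Data.Bool.Properties as Bool
open import Data.Fin.Base using (Fin; zero; suc; toℕ)
open import Data.Fin.Patterns using (0F; 1F; 2F)
import Data.Fin.Properties as Fin
open import Data.Fin.Subset using (Subset; inside; ∣_∣; _∩_; ⊥)
import Data.Fin.Subset.Properties as Subset
import Data.Integer.Base as ℤ
import Data.Integer.Properties as ℤ
open import Data.List.Base as List using (List; length; _++_; concat; tabulate)
import Data.List.Properties as List
open import Data.Nat.Base
open import Data.Nat.Properties
open import Data.Nat.Tactic.RingSolver using (solve-∀)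
open import Data.Product.Base using (Σ-syntax; ∃; ∃₂; _×_; _,_; proj₁; proj₂)
open import Data.Rational.Base as ℚ using (ℚ; 0ℚ; 1ℚ)
import Data.Rational.Properties as ℚ
open import Data.Rational.Solver using (module +-*-Solver)
open import Data.Rational.Unnormalised.Base as ℚᵘ using (mkℚᵘ)
import Data.Rational.Unnormalised.Properties as ℚᵘ
open import Data.Sum.Base using (inj₁; inj₂)
open import Data.Vec.Base as Vec using (Vec; []; _∷_; lookup; _[_]≔_)
import Data.Vec.Properties as Vec
open import Function.Base using (_∘_; _$_)
open import Relation.Binary.PropositionalEquality
open import Relation.Nullary.Decidable using (yes; no; ⌊_⌋)
open import Relation.Nullary.Negation using (contradiction)
open import Algebra.Properties.Semiring.Sum +-*-semiring
  using (sum; sum-syntax; sum-cong-≗; ∑-comm; ∑-distrib-+; *-distribˡ-sum; *-distribʳ-sum)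
open +-*-Solver using (solve; _:+_; _:*_; con) renaming (_:=_ to _⊜_)

-- Bounds on the exponential series

-- The bound has no additive constant to absorb the last round. That round is paid for by the
-- quarter in n² / 4, which comes from the two colour classes having total size n; counting all n²
-- pairs would leave it uncompensated in this argument. The logarithm is accessible only through
-- partial sums of exp, where a law such as exp (2q) = (exp q)² would call for products of series.
-- Hence exp (1 / 2k) is compared with a rational, and the squaring that turns n into n² is done on
-- that rational: (2k - 1)² = 4k (k - 1) + 1 gives (2k / (2k - 1))² ≤ k / (k - 1), the reciprocal of
-- the greedy decay. For k = 1 this ratio is undefined and the claim is checked directly.

toℚᵘ-ℕ→ℚ : ∀ m → ℚ.toℚᵘ (ℕ→ℚ m) ℚᵘ.≃ mkℚᵘ (ℤ.+ m) 0
toℚᵘ-ℕ→ℚ m = ℚ.toℚᵘ-fromℚᵘ (mkℚᵘ (ℤ.+ m) 0)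

ℕ→ℚ-homo-+ : ∀ m n → ℕ→ℚ (m + n) ≡ ℕ→ℚ m ℚ.+ ℕ→ℚ n
ℕ→ℚ-homo-+ m n = ℚ.toℚᵘ-injective (begin
  ℚ.toℚᵘ (ℕ→ℚ (m + n))                       ≈⟨ toℚᵘ-ℕ→ℚ (m + n) ⟩
  mkℚᵘ (ℤ.+ (m + n)) 0                       ≈⟨ ℚᵘ.*≡* (cong (ℤ._* ℤ.1ℤ) numerators) ⟩
  mkℚᵘ (ℤ.+ m) 0 ℚᵘ.+ mkℚᵘ (ℤ.+ n) 0         ≈⟨ ℚᵘ.+-cong (toℚᵘ-ℕ→ℚ m) (toℚᵘ-ℕ→ℚ n) ⟨
  ℚ.toℚᵘ (ℕ→ℚ m) ℚᵘ.+ ℚ.toℚᵘ (ℕ→ℚ n)         ≈⟨ ℚ.toℚᵘ-homo-+ (ℕ→ℚ m) (ℕ→ℚ n) ⟨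
  ℚ.toℚᵘ (ℕ→ℚ m ℚ.+ ℕ→ℚ n)                   ∎)
  where
  open ℚᵘ.≃-Reasoning
  numerators : ℤ.+ (m + n) ≡ ℤ.+ m ℤ.* ℤ.1ℤ ℤ.+ ℤ.+ n ℤ.* ℤ.1ℤ
  numerators = sym (cong₂ ℤ._+_ (ℤ.*-identityʳ (ℤ.+ m)) (ℤ.*-identityʳ (ℤ.+ n)))

ℕ→ℚ-homo-* : ∀ m n → ℕ→ℚ (m * n) ≡ ℕ→ℚ m ℚ.* ℕ→ℚ n
ℕ→ℚ-homo-* m n = ℚ.toℚᵘ-injective (begin
  ℚ.toℚᵘ (ℕ→ℚ (m * n))                       ≈⟨ toℚᵘ-ℕ→ℚ (m * n) ⟩
  mkℚᵘ (ℤ.+ (m * n)) 0                       ≈⟨ ℚᵘ.*≡* (cong (ℤ._* ℤ.1ℤ) (ℤ.pos-* m n)) ⟩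
  mkℚᵘ (ℤ.+ m) 0 ℚᵘ.* mkℚᵘ (ℤ.+ n) 0         ≈⟨ ℚᵘ.*-cong (toℚᵘ-ℕ→ℚ m) (toℚᵘ-ℕ→ℚ n) ⟨
  ℚ.toℚᵘ (ℕ→ℚ m) ℚᵘ.* ℚ.toℚᵘ (ℕ→ℚ n)         ≈⟨ ℚ.toℚᵘ-homo-* (ℕ→ℚ m) (ℕ→ℚ n) ⟨
  ℚ.toℚᵘ (ℕ→ℚ m ℚ.* ℕ→ℚ n)                   ∎)
  where open ℚᵘ.≃-Reasoning

0≤ℕ→ℚ : ∀ m → 0ℚ ℚ.≤ ℕ→ℚ m
0≤ℕ→ℚ m = ℚ.nonNegative⁻¹ (ℕ→ℚ m) {{ℚ.normalize-nonNeg m 1}}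

ℕ→ℚ-mono-≤ : ∀ {m n} → m ≤ n → ℕ→ℚ m ℚ.≤ ℕ→ℚ n
ℕ→ℚ-mono-≤ {m} {n} m≤n = begin
  ℕ→ℚ m                  ≡⟨ ℚ.+-identityʳ (ℕ→ℚ m) ⟨
  ℕ→ℚ m ℚ.+ 0ℚ           ≤⟨ ℚ.+-monoʳ-≤ (ℕ→ℚ m) (0≤ℕ→ℚ (n ∸ m)) ⟩
  ℕ→ℚ m ℚ.+ ℕ→ℚ (n ∸ m)  ≡⟨ ℕ→ℚ-homo-+ m (n ∸ m) ⟨
  ℕ→ℚ (m + (n ∸ m))      ≡⟨ cong ℕ→ℚ (m+[n∸m]≡n m≤n) ⟩
  ℕ→ℚ n                  ∎
  where open ℚ.≤-Reasoning

ℕ→ℚ-cancel-< : ∀ {m n} → ℕ→ℚ m ℚ.< ℕ→ℚ n → m < n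
ℕ→ℚ-cancel-< m<n = ≰⇒> λ n≤m → ℚ.<-irrefl refl (ℚ.<-≤-trans m<n (ℕ→ℚ-mono-≤ n≤m))

unitFraction : ℕ → ℚ
unitFraction c = ℤ.+ 1 ℚ./ suc c

0≤unitFraction : ∀ c → 0ℚ ℚ.≤ unitFraction c
0≤unitFraction c = ℚ.nonNegative⁻¹ (unitFraction c) {{ℚ.normalize-nonNeg 1 (suc c)}}

*-unitFraction : ∀ c → ℕ→ℚ (suc c) ℚ.* unitFraction c ≡ 1ℚ
*-unitFraction c = ℚ.toℚᵘ-injective (begin
  ℚ.toℚᵘ (ℕ→ℚ (suc c) ℚ.* unitFraction c)
    ≈⟨ ℚ.toℚᵘ-homo-* (ℕ→ℚ (suc c)) (unitFraction c) ⟩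
  ℚ.toℚᵘ (ℕ→ℚ (suc c)) ℚᵘ.* ℚ.toℚᵘ (unitFraction c)
    ≈⟨ ℚᵘ.*-cong (toℚᵘ-ℕ→ℚ (suc c)) (ℚ.toℚᵘ-fromℚᵘ (mkℚᵘ (ℤ.+ 1) c)) ⟩
  mkℚᵘ (ℤ.+ suc c) 0 ℚᵘ.* mkℚᵘ (ℤ.+ 1) c
    ≈⟨ ℚᵘ.*≡* (trans (ℤ.*-identityʳ _) (trans (ℤ.*-identityʳ _)
         (sym (trans (ℤ.*-identityˡ _) (cong ℤ.+_ (*-identityˡ (suc c))))))) ⟩
  ℚ.toℚᵘ 1ℚ ∎)
  where open ℚᵘ.≃-Reasoning

*-monoˡ : ∀ {r p q} → 0ℚ ℚ.≤ r → p ℚ.≤ q → r ℚ.* p ℚ.≤ r ℚ.* q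
*-monoˡ {r} 0≤r = ℚ.*-monoˡ-≤-nonNeg r {{ℚ.nonNegative 0≤r}}

*-mono : ∀ {p q r s} → 0ℚ ℚ.≤ r → 0ℚ ℚ.≤ q → p ℚ.≤ q → r ℚ.≤ s → p ℚ.* r ℚ.≤ q ℚ.* s
*-mono {p} {q} {r} {s} 0≤r 0≤q p≤q r≤s =
  ℚ.≤-trans (ℚ.*-monoʳ-≤-nonNeg r {{ℚ.nonNegative 0≤r}} p≤q) (*-monoˡ 0≤q r≤s)

0≤* : ∀ {p q} → 0ℚ ℚ.≤ p → 0ℚ ℚ.≤ q → 0ℚ ℚ.≤ p ℚ.* q
0≤* {p} {q} 0≤p 0≤q = subst (ℚ._≤ p ℚ.* q) (ℚ.*-zeroʳ p) (*-monoˡ 0≤p 0≤q)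

0≤+ : ∀ {p q} → 0ℚ ℚ.≤ p → 0ℚ ℚ.≤ q → 0ℚ ℚ.≤ p ℚ.+ q
0≤+ = ℚ.+-mono-≤

0≤expTerm : ∀ {q} → 0ℚ ℚ.≤ q → ∀ j → 0ℚ ℚ.≤ expTerm q j
0≤expTerm 0≤q zero    = 0≤ℕ→ℚ 1
0≤expTerm 0≤q (suc j) = 0≤* (0≤expTerm 0≤q j) (0≤* 0≤q (0≤unitFraction j))

expTerm-mono : ∀ {y z} → 0ℚ ℚ.≤ y → y ℚ.≤ z → ∀ j → expTerm y j ℚ.≤ expTerm z j
expTerm-mono 0≤y y≤z zero    = ℚ.≤-refl
expTerm-mono 0≤y y≤z (suc j) =
  *-mono (0≤* 0≤y (0≤unitFraction j)) (0≤expTerm (ℚ.≤-trans 0≤y y≤z) j)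
    (expTerm-mono 0≤y y≤z j)
    (*-mono (0≤unitFraction j) (ℚ.≤-trans 0≤y y≤z) y≤z ℚ.≤-refl)

expSum-mono : ∀ {y z} → 0ℚ ℚ.≤ y → y ℚ.≤ z → ∀ j → expSum y j ℚ.≤ expSum z j
expSum-mono 0≤y y≤z zero    = ℚ.≤-refl
expSum-mono 0≤y y≤z (suc j) = ℚ.+-mono-≤ (expSum-mono 0≤y y≤z j) (expTerm-mono 0≤y y≤z j)

-- Trades a factor `q` for a factor `suc j`; this is how the coefficient in `expTerm-+` grows by one
-- under induction.
expTerm-suc : ∀ q j → ℕ→ℚ (suc j) ℚ.* expTerm q (suc j) ≡ expTerm q j ℚ.* q
expTerm-suc q j = begin
  n ℚ.* (t ℚ.* (q ℚ.* u)) ≡⟨ solve 4 (λ n t q u → n :* (t :* (q :* u)) ⊜ (n :* u) :* (t :* q)) refl n t q u ⟩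
  (n ℚ.* u) ℚ.* (t ℚ.* q) ≡⟨ cong (ℚ._* (t ℚ.* q)) (*-unitFraction j) ⟩
  1ℚ ℚ.* (t ℚ.* q)        ≡⟨ ℚ.*-identityˡ _ ⟩
  t ℚ.* q                 ∎
  where
  open ≡-Reasoning
  n = ℕ→ℚ (suc j)
  t = expTerm q j
  u = unitFraction j

-- The mean value estimate zʲ⁺¹ - yʲ⁺¹ ≤ (j + 1) (z - y) zʲ for z = y + x.
expTerm-+ : ∀ {x y} → 0ℚ ℚ.≤ x → 0ℚ ℚ.≤ y → ∀ j →
  expTerm (y ℚ.+ x) (suc j) ℚ.≤ expTerm y (suc j) ℚ.+ x ℚ.* expTerm (y ℚ.+ x) j
expTerm-+ {x} {y} 0≤x 0≤y zero = ℚ.≤-reflexive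
  (solve 2 (λ x y → con 1ℚ :* ((y :+ x) :* con 1ℚ) ⊜ con 1ℚ :* (y :* con 1ℚ) :+ x :* con 1ℚ) refl x y)
expTerm-+ {x} {y} 0≤x 0≤y (suc j) = begin
  t₁ ℚ.* ((y ℚ.+ x) ℚ.* u)
    ≡⟨ solve 4 (λ t x y u → t :* ((y :+ x) :* u) ⊜ u :* (t :* y :+ t :* x)) refl t₁ x y u ⟩
  u ℚ.* (t₁ ℚ.* y ℚ.+ t₁ ℚ.* x)
    ≤⟨ *-monoˡ (0≤unitFraction (suc j)) (ℚ.+-monoˡ-≤ (t₁ ℚ.* x)
         (ℚ.*-monoʳ-≤-nonNeg y {{ℚ.nonNegative 0≤y}} (expTerm-+ 0≤x 0≤y j))) ⟩
  u ℚ.* ((s₁ ℚ.+ x ℚ.* t₀) ℚ.* y ℚ.+ t₁ ℚ.* x)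
    ≡⟨ solve 6 (λ u s x y t t₁ → u :* ((s :+ x :* t) :* y :+ t₁ :* x)
                ⊜ u :* (s :* y :+ (x :* (t :* y) :+ t₁ :* x))) refl u s₁ x y t₀ t₁ ⟩
  u ℚ.* (s₁ ℚ.* y ℚ.+ (x ℚ.* (t₀ ℚ.* y) ℚ.+ t₁ ℚ.* x))
    -- Raising the factor `y` to `y + x` in the middle term is the only loss besides the induction
    -- hypothesis; `expTerm-suc` needs the full argument.
    ≤⟨ *-monoˡ (0≤unitFraction (suc j)) (ℚ.+-monoʳ-≤ (s₁ ℚ.* y) (ℚ.+-monoˡ-≤ (t₁ ℚ.* x)
         (*-monoˡ 0≤x (*-monoˡ (0≤expTerm 0≤z j) y≤z)))) ⟩
  u ℚ.* (s₁ ℚ.* y ℚ.+ (x ℚ.* (t₀ ℚ.* (y ℚ.+ x)) ℚ.+ t₁ ℚ.* x))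
    ≡⟨ cong (λ w → u ℚ.* (s₁ ℚ.* y ℚ.+ (x ℚ.* w ℚ.+ t₁ ℚ.* x))) (expTerm-suc (y ℚ.+ x) j) ⟨
  u ℚ.* (s₁ ℚ.* y ℚ.+ (x ℚ.* (n ℚ.* t₁) ℚ.+ t₁ ℚ.* x))
    ≡⟨ solve 6 (λ u s y x n t₁ → u :* (s :* y :+ (x :* (n :* t₁) :+ t₁ :* x))
                ⊜ s :* (y :* u) :+ x :* (((con 1ℚ :+ n) :* u) :* t₁)) refl u s₁ y x n t₁ ⟩
  s₁ ℚ.* (y ℚ.* u) ℚ.+ x ℚ.* (((1ℚ ℚ.+ n) ℚ.* u) ℚ.* t₁)
    ≡⟨ cong (λ w → s₁ ℚ.* (y ℚ.* u) ℚ.+ x ℚ.* (w ℚ.* t₁))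
         (trans (cong (ℚ._* u) (sym (ℕ→ℚ-homo-+ 1 (suc j)))) (*-unitFraction (suc j))) ⟩
  s₁ ℚ.* (y ℚ.* u) ℚ.+ x ℚ.* (1ℚ ℚ.* t₁)
    ≡⟨ cong (λ w → s₁ ℚ.* (y ℚ.* u) ℚ.+ x ℚ.* w) (ℚ.*-identityˡ t₁) ⟩
  s₁ ℚ.* (y ℚ.* u) ℚ.+ x ℚ.* t₁ ∎
  where
  open ℚ.≤-Reasoning
  u = unitFraction (suc j)
  n = ℕ→ℚ (suc j)
  t₀ = expTerm (y ℚ.+ x) j
  t₁ = expTerm (y ℚ.+ x) (suc j)
  s₁ = expTerm y (suc j)
  0≤z = 0≤+ 0≤y 0≤x
  y≤z = subst (ℚ._≤ y ℚ.+ x) (ℚ.+-identityʳ y) (ℚ.+-monoʳ-≤ y 0≤x)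

-- Summation of `expTerm-+`. The terms of index 0 are both 1, so the sum multiplied by `x` is one
-- term shorter. In the limit this says (1 - x) exp (y + x) ≤ exp y.
expSum-+ : ∀ {x y} → 0ℚ ℚ.≤ x → 0ℚ ℚ.≤ y → ∀ j →
  expSum (y ℚ.+ x) (suc j) ℚ.≤ expSum y (suc j) ℚ.+ x ℚ.* expSum (y ℚ.+ x) j
expSum-+ {x} 0≤x 0≤y zero = ℚ.≤-reflexive
  (solve 1 (λ x → con 0ℚ :+ con 1ℚ ⊜ (con 0ℚ :+ con 1ℚ) :+ x :* con 0ℚ) refl x)
expSum-+ {x} {y} 0≤x 0≤y (suc j) = begin
  e₁ ℚ.+ t₁                                     ≤⟨ ℚ.+-mono-≤ (expSum-+ 0≤x 0≤y j) (expTerm-+ 0≤x 0≤y j) ⟩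
  (s ℚ.+ x ℚ.* e₀) ℚ.+ (t′ ℚ.+ x ℚ.* t₀)        ≡⟨ solve 5 (λ s x e t′ t → (s :+ x :* e) :+ (t′ :+ x :* t) ⊜ (s :+ t′) :+ x :* (e :+ t)) refl s x e₀ t′ t₀ ⟩
  (s ℚ.+ t′) ℚ.+ x ℚ.* (e₀ ℚ.+ t₀)              ∎
  where
  open ℚ.≤-Reasoning
  e₀ = expSum (y ℚ.+ x) j
  e₁ = expSum (y ℚ.+ x) (suc j)
  t₀ = expTerm (y ℚ.+ x) j
  t₁ = expTerm (y ℚ.+ x) (suc j)
  s = expSum y (suc j)
  t′ = expTerm y (suc j)

expSum-0 : ∀ j → expSum 0ℚ (suc j) ≡ 1ℚ
expSum-0 zero    = refl
expSum-0 (suc j) = begin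
  expSum 0ℚ (suc j) ℚ.+ t ℚ.* (0ℚ ℚ.* u) ≡⟨ cong (expSum 0ℚ (suc j) ℚ.+_) (solve 2 (λ t u → t :* (con 0ℚ :* u) ⊜ con 0ℚ) refl t u) ⟩
  expSum 0ℚ (suc j) ℚ.+ 0ℚ               ≡⟨ ℚ.+-identityʳ _ ⟩
  expSum 0ℚ (suc j)                      ≡⟨ expSum-0 j ⟩
  1ℚ                                     ∎
  where
  open ≡-Reasoning
  t = expTerm 0ℚ j
  u = unitFraction j

-- For x = 1 / (c + 1) the factor 1 - x is c / (c + 1). Lengthening the sum on the right of
-- `expSum-+` by one term puts the same sum `e` on both sides; adding `e` and cancelling it replaces
-- the subtraction.
expSum-unitFraction-step : ∀ c {y} → 0ℚ ℚ.≤ y → ∀ j →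
  ℕ→ℚ c ℚ.* expSum (y ℚ.+ unitFraction c) (suc j) ℚ.≤ ℕ→ℚ (suc c) ℚ.* expSum y (suc j)
expSum-unitFraction-step c {y} 0≤y j = cancel (begin
  ℕ→ℚ c ℚ.* e ℚ.+ e             ≡⟨ solve 2 (λ c e → c :* e :+ e ⊜ (con 1ℚ :+ c) :* e) refl (ℕ→ℚ c) e ⟩
  (1ℚ ℚ.+ ℕ→ℚ c) ℚ.* e          ≡⟨ cong (ℚ._* e) (ℕ→ℚ-homo-+ 1 c) ⟨
  b ℚ.* e                       ≤⟨ *-monoˡ (0≤ℕ→ℚ (suc c)) (expSum-+ 0≤x 0≤y j) ⟩
  b ℚ.* (s ℚ.+ x ℚ.* e₀)        ≤⟨ *-monoˡ (0≤ℕ→ℚ (suc c)) (ℚ.+-monoʳ-≤ s (*-monoˡ 0≤x e₀≤e)) ⟩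
  b ℚ.* (s ℚ.+ x ℚ.* e)         ≡⟨ solve 4 (λ b s x e → b :* (s :+ x :* e) ⊜ b :* s :+ (b :* x) :* e) refl b s x e ⟩
  b ℚ.* s ℚ.+ (b ℚ.* x) ℚ.* e   ≡⟨ cong (λ w → b ℚ.* s ℚ.+ w ℚ.* e) (*-unitFraction c) ⟩
  b ℚ.* s ℚ.+ 1ℚ ℚ.* e          ≡⟨ cong (b ℚ.* s ℚ.+_) (ℚ.*-identityˡ e) ⟩
  b ℚ.* s ℚ.+ e                 ∎)
  where
  open ℚ.≤-Reasoning
  x = unitFraction c
  0≤x = 0≤unitFraction c
  b = ℕ→ℚ (suc c)
  e = expSum (y ℚ.+ x) (suc j)
  e₀ = expSum (y ℚ.+ x) j
  s = expSum y (suc j)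
  e₀≤e : e₀ ℚ.≤ e
  e₀≤e = subst (ℚ._≤ e) (ℚ.+-identityʳ e₀) (ℚ.+-monoʳ-≤ e₀ (0≤expTerm (0≤+ 0≤y 0≤x) j))
  cancel : ∀ {p q} → p ℚ.+ e ℚ.≤ q ℚ.+ e → p ℚ.≤ q
  cancel p≤q = ℚ.≮⇒≥ λ q<p → ℚ.<-irrefl refl (ℚ.<-≤-trans (ℚ.+-monoˡ-< e q<p) p≤q)

-- exp (g / b) ≤ (b / (b - 1))ᵍ for b = c + 1
expSum-≤-power : ∀ c g j →
  ℕ→ℚ (c ^ g) ℚ.* expSum (ℕ→ℚ g ℚ.* unitFraction c) (suc j) ℚ.≤ ℕ→ℚ (suc c ^ g)
expSum-≤-power c zero j = ℚ.≤-reflexive (begin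
  1ℚ ℚ.* expSum (0ℚ ℚ.* unitFraction c) (suc j) ≡⟨ ℚ.*-identityˡ _ ⟩
  expSum (0ℚ ℚ.* unitFraction c) (suc j)        ≡⟨ cong (λ q → expSum q (suc j)) (ℚ.*-zeroˡ (unitFraction c)) ⟩
  expSum 0ℚ (suc j)                             ≡⟨ expSum-0 j ⟩
  1ℚ                                            ∎)
  where open ≡-Reasoning
expSum-≤-power c (suc g) j = begin
  ℕ→ℚ (c * c ^ g) ℚ.* expSum (ℕ→ℚ (suc g) ℚ.* x) (suc j)
    ≡⟨ cong₂ (λ a q → a ℚ.* expSum q (suc j)) (ℕ→ℚ-homo-* c (c ^ g)) split ⟩
  (ℕ→ℚ c ℚ.* ℕ→ℚ (c ^ g)) ℚ.* expSum (y ℚ.+ x) (suc j)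
    ≡⟨ solve 3 (λ a p e → (a :* p) :* e ⊜ p :* (a :* e)) refl (ℕ→ℚ c) (ℕ→ℚ (c ^ g)) (expSum (y ℚ.+ x) (suc j)) ⟩
  ℕ→ℚ (c ^ g) ℚ.* (ℕ→ℚ c ℚ.* expSum (y ℚ.+ x) (suc j))
    ≤⟨ *-monoˡ (0≤ℕ→ℚ (c ^ g))
         (expSum-unitFraction-step c (0≤* (0≤ℕ→ℚ g) (0≤unitFraction c)) j) ⟩
  ℕ→ℚ (c ^ g) ℚ.* (ℕ→ℚ (suc c) ℚ.* expSum y (suc j))
    ≡⟨ solve 3 (λ p b e → p :* (b :* e) ⊜ b :* (p :* e)) refl (ℕ→ℚ (c ^ g)) (ℕ→ℚ (suc c)) (expSum y (suc j)) ⟩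
  ℕ→ℚ (suc c) ℚ.* (ℕ→ℚ (c ^ g) ℚ.* expSum y (suc j))
    ≤⟨ *-monoˡ (0≤ℕ→ℚ (suc c)) (expSum-≤-power c g j) ⟩
  ℕ→ℚ (suc c) ℚ.* ℕ→ℚ (suc c ^ g)
    ≡⟨ ℕ→ℚ-homo-* (suc c) (suc c ^ g) ⟨
  ℕ→ℚ (suc c ^ suc g) ∎
  where
  open ℚ.≤-Reasoning
  x = unitFraction c
  y = ℕ→ℚ g ℚ.* x
  split : ℕ→ℚ (suc g) ℚ.* x ≡ y ℚ.+ x
  split = trans (cong (ℚ._* x) (ℕ→ℚ-homo-+ 1 g))
                (solve 2 (λ g x → (con 1ℚ :+ g) :* x ⊜ g :* x :+ x) refl (ℕ→ℚ g) x)

-- With b = c + 2, the second hypothesis says q < g / b, so exp q is at most exp (g / b) and the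
-- power estimate applies. Since b ≥ 2, the power of b - 1 is positive and multiplying by it keeps
-- the inequality strict.
ln-lower-bound : ∀ n c g {q} → ln[ n ]< q → ℕ→ℚ (2 + c) ℚ.* q ℚ.< ℕ→ℚ g →
                 n * suc c ^ g < (2 + c) ^ g
ln-lower-bound n c g {q} (0≤q , j , n<exp) bq<g = ℕ→ℚ-cancel-< (begin-strict
  ℕ→ℚ (n * suc c ^ g)
    ≡⟨ trans (cong ℕ→ℚ (*-comm n (suc c ^ g))) (ℕ→ℚ-homo-* (suc c ^ g) n) ⟩
  p ℚ.* ℕ→ℚ n
    <⟨ ℚ.*-monoʳ-<-pos p {{ℚ.normalize-pos (suc c ^ g) 1 {{_}} {{m^n≢0 (suc c) g}}}} n<exp ⟩
  p ℚ.* expSum q j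
    -- One more term is added because `expSum-≤-power` speaks of sums of `suc j` terms.
    ≡⟨ cong (p ℚ.*_) (ℚ.+-identityʳ (expSum q j)) ⟨
  p ℚ.* (expSum q j ℚ.+ 0ℚ)
    ≤⟨ *-monoˡ (0≤ℕ→ℚ (suc c ^ g)) (ℚ.+-monoʳ-≤ (expSum q j) (0≤expTerm 0≤q j)) ⟩
  p ℚ.* expSum q (suc j)
    ≤⟨ *-monoˡ (0≤ℕ→ℚ (suc c ^ g)) (expSum-mono 0≤q q≤gx (suc j)) ⟩
  p ℚ.* expSum (ℕ→ℚ g ℚ.* x) (suc j)
    ≤⟨ expSum-≤-power (suc c) g j ⟩
  ℕ→ℚ ((2 + c) ^ g) ∎)
  where
  open ℚ.≤-Reasoning
  p = ℕ→ℚ (suc c ^ g)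
  x = unitFraction (suc c)
  b = ℕ→ℚ (2 + c)
  q≤gx : q ℚ.≤ ℕ→ℚ g ℚ.* x
  q≤gx = begin
    q                ≡⟨ ℚ.*-identityˡ q ⟨
    1ℚ ℚ.* q         ≡⟨ cong (ℚ._* q) (*-unitFraction (suc c)) ⟨
    (b ℚ.* x) ℚ.* q  ≡⟨ solve 3 (λ b x q → (b :* x) :* q ⊜ x :* (b :* q)) refl b x q ⟩
    x ℚ.* (b ℚ.* q)  ≤⟨ *-monoˡ (0≤unitFraction (suc c)) (ℚ.<⇒≤ bq<g) ⟩
    x ℚ.* ℕ→ℚ g      ≡⟨ ℚ.*-comm x (ℕ→ℚ g) ⟩
    ℕ→ℚ g ℚ.* x      ∎

-- Comparison of the exponential bound with the greedy decay

^-distribʳ-* : ∀ g m n → (m * n) ^ g ≡ m ^ g * n ^ g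
^-distribʳ-* zero    m n = refl
^-distribʳ-* (suc g) m n =
  trans (cong (m * n *_) (^-distribʳ-* g m n)) (interchange m n (m ^ g) (n ^ g))
  where
  interchange : ∀ a b c d → a * b * (c * d) ≡ a * c * (b * d)
  interchange = solve-∀

-- Here k = c + 1 and g = h + 1. A failure is squared and multiplied out so that (4k)^g cancels,
-- leaving n² (k - 1)^g < k^g. The hypotheses give the reverse: k^h is bounded by the decay, and the
-- remaining factor k by 4 (k - 1), whose 4 is absorbed by 4m ≤ n².
approximation-bound : ∀ n m c h →
  suc c ^ h ≤ c ^ h * m → 4 * m ≤ n * n →
  (2 + 2 * c) ^ suc h ≤ n * suc (2 * c) ^ suc h
-- For k = 1 the decay factor is 0, so a second round is impossible.
approximation-bound n m zero (suc h) k^h≤ 4m≤ =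
  contradiction (subst (_≤ 0) (^-zeroˡ (suc h)) k^h≤) λ ()
-- For k = 1 and one round the claim is 2 ≤ n, which follows from 4 ≤ 4m ≤ n².
approximation-bound n m zero zero 1≤m 4m≤ = ≮⇒≥ λ n1<2 →
  <⇒≱ (s≤s (*-mono-≤ (n≤1 n1<2) (n≤1 n1<2)))
      (≤-trans (s≤s (s≤s z≤n)) (≤-trans (*-monoʳ-≤ 4 1≤m′) 4m≤))
  where
  1≤m′ : 1 ≤ m
  1≤m′ = subst (1 ≤_) (*-identityˡ m) 1≤m
  n≤1 : n * 1 < 2 → n ≤ 1
  n≤1 lt = ≤-pred (subst (_< 2) (*-identityʳ n) lt)
approximation-bound n m c@(suc d) h k^h≤ 4m≤ = ≮⇒≥ λ nA<B →
  <⇒≱ (*-cancelˡ-< ((4 * k) ^ g) _ _ (begin-strict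
    (4 * k) ^ g * (n * n * c ^ g)
      ≡⟨ regroup₁ ((4 * k) ^ g) n (c ^ g) ⟩
    n * n * ((4 * k) ^ g * c ^ g)
      ≡⟨ cong (n * n *_) (^-distribʳ-* g (4 * k) c) ⟨
    n * n * (4 * k * c) ^ g
      ≤⟨ *-monoʳ-≤ (n * n) (^-monoˡ-≤ g 4kc≤A²) ⟩
    n * n * (A * A) ^ g
      ≡⟨ cong (n * n *_) (^-distribʳ-* g A A) ⟩
    n * n * (A ^ g * A ^ g)
      ≡⟨ regroup₂ n (A ^ g) ⟩
    n * A ^ g * (n * A ^ g)
      <⟨ *-mono-< nA<B nA<B ⟩
    B ^ g * B ^ g
      ≡⟨ ^-distribʳ-* g B B ⟨
    (B * B) ^ g
      ≡⟨ cong (_^ g) (B²≡4k² c) ⟩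
    (4 * k * k) ^ g
      ≡⟨ ^-distribʳ-* g (4 * k) k ⟩
    (4 * k) ^ g * k ^ g ∎))
  (begin
    k ^ g                ≤⟨ *-mono-≤ k≤4c k^h≤ ⟩
    4 * c * (c ^ h * m)  ≡⟨ regroup₃ c (c ^ h) m ⟩
    4 * m * c ^ g        ≤⟨ *-monoˡ-≤ (c ^ g) 4m≤ ⟩
    n * n * c ^ g        ∎)
  where
  open ≤-Reasoning
  k = suc c
  g = suc h
  A = suc (2 * c)
  B = 2 + 2 * c
  regroup₁ : ∀ a n b → a * (n * n * b) ≡ n * n * (a * b)
  regroup₁ = solve-∀
  regroup₂ : ∀ n a → n * n * (a * a) ≡ n * a * (n * a)
  regroup₂ = solve-∀
  B²≡4k² : ∀ c → (2 + 2 * c) * (2 + 2 * c) ≡ 4 * suc c * suc c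
  B²≡4k² = solve-∀
  regroup₃ : ∀ c p m → 4 * c * (p * m) ≡ 4 * m * (c * p)
  regroup₃ = solve-∀
  4kc+1≡A² : ∀ c → 1 + 4 * suc c * c ≡ suc (2 * c) * suc (2 * c)
  4kc+1≡A² = solve-∀
  k+[3d+2]≡4c : ∀ d → 2 + d + (2 + 3 * d) ≡ 4 * suc d
  k+[3d+2]≡4c = solve-∀
  4kc≤A² : 4 * k * c ≤ A * A
  4kc≤A² = subst (4 * k * c ≤_) (4kc+1≡A² c) (n≤1+n _)
  k≤4c : k ≤ 4 * c
  k≤4c = subst (k ≤_) (k+[3d+2]≡4c d) (m≤m+n k _)

-- It suffices to refute 2kq < g at each `q` of the cut: there `ln-lower-bound` and
-- `approximation-bound` contradict each other.
≤·ln-intro : ∀ n m c h → suc c ^ h ≤ c ^ h * m → 4 * m ≤ n * n →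
             suc h ≤[ 2 * suc c ·ln n ]
≤·ln-intro n m c h k^h≤ 4m≤ q n<q = ℚ.≮⇒≥ λ bq<g →
  <⇒≱ (ln-lower-bound n (2 * c) (suc h) n<q
         (subst (λ b → ℕ→ℚ b ℚ.* q ℚ.< ℕ→ℚ (suc h)) (*-suc 2 c) bq<g))
      (approximation-bound n m c h k^h≤ 4m≤)

-- Covering the red-blue pairs

sum-mono-≤ : ∀ {n} {f g : Fin n → ℕ} → (∀ i → f i ≤ g i) → sum f ≤ sum g
sum-mono-≤ {zero}  f≤g = z≤n
sum-mono-≤ {suc n} f≤g = +-mono-≤ (f≤g zero) (sum-mono-≤ (f≤g ∘ suc))

term≤sum : ∀ {n} (f : Fin n → ℕ) i → f i ≤ sum f
term≤sum f zero    = m≤m+n _ _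
term≤sum f (suc i) = ≤-trans (term≤sum (f ∘ suc) i) (m≤n+m _ _)

sum-zero : ∀ {n} (f : Fin n → ℕ) → (∀ i → f i ≡ 0) → sum f ≡ 0
sum-zero {zero}  f f≡0 = refl
sum-zero {suc n} f f≡0 = cong₂ _+_ (f≡0 zero) (sum-zero (f ∘ suc) (f≡0 ∘ suc))

sum-one : ∀ n → ∑[ i < n ] 1 ≡ n
sum-one zero    = refl
sum-one (suc n) = cong suc (sum-one n)

∣S∣≡sum : ∀ {n} (S : Subset n) → ∣ S ∣ ≡ ∑[ v < n ] bit (lookup S v)
∣S∣≡sum []          = refl
∣S∣≡sum (true ∷ S)  = cong suc (∣S∣≡sum S)
∣S∣≡sum (false ∷ S) = ∣S∣≡sum S

∣S[v]≔inside∣≤ : ∀ {n} (S : Subset n) v → ∣ S [ v ]≔ inside ∣ ≤ suc ∣ S ∣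
∣S[v]≔inside∣≤ (true ∷ S)  zero    = n≤1+n _
∣S[v]≔inside∣≤ (false ∷ S) zero    = ≤-refl
∣S[v]≔inside∣≤ (true ∷ S)  (suc v) = s≤s (∣S[v]≔inside∣≤ S v)
∣S[v]≔inside∣≤ (false ∷ S) (suc v) = ∣S[v]≔inside∣≤ S v

bit-mono : ∀ {x y} → (x ≡ true → y ≡ true) → bit x ≤ bit y
bit-mono {false}         _   = z≤n
bit-mono {true}  {true}  _   = ≤-refl
bit-mono {true}  {false} x⇒y = contradiction (x⇒y refl) λ ()

bit≡0 : ∀ {x} → bit x ≡ 0 → x ≡ false
bit≡0 {false} _ = refl

∧-true : ∀ {x y} → x ∧ y ≡ true → x ≡ true × y ≡ true
∧-true {true} eq = refl , eq

xor-false : ∀ x y → x xor y ≡ false → x ≡ y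
xor-false true  true  _ = refl
xor-false false false _ = refl

isRed : Colour → Bool
isRed red  = true
isRed blue = false

isRed-true : ∀ {x} → isRed x ≡ true → x ≡ red
isRed-true {red} _ = refl

isRed-false : ∀ {x} → not (isRed x) ≡ true → x ≡ blue
isRed-false {blue} _ = refl

-- The difference of the two sides is (m - n)²; the case split only keeps the subtraction in ℕ.
4mn≤[m+n]² : ∀ m n → 4 * (m * n) ≤ (m + n) * (m + n)
4mn≤[m+n]² m n with ≤-total m n
... | inj₁ m≤n = subst (λ n → 4 * (m * n) ≤ (m + n) * (m + n)) (m+[n∸m]≡n m≤n)
                   (subst (4 * (m * (m + (n ∸ m))) ≤_) (expand m (n ∸ m)) (m≤m+n _ _))
  where
  expand : ∀ m d → 4 * (m * (m + d)) + d * d ≡ (m + (m + d)) * (m + (m + d))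
  expand = solve-∀
... | inj₂ n≤m = subst (λ m → 4 * (m * n) ≤ (m + n) * (m + n)) (m+[n∸m]≡n n≤m)
                   (subst (4 * ((n + (m ∸ n)) * n) ≤_) (expand n (m ∸ n)) (m≤m+n _ _))
  where
  expand : ∀ n d → 4 * ((n + d) * n) + d * d ≡ (n + d + n) * (n + d + n)
  expand = solve-∀

module _ {n : ℕ} (G : Graph n) where

  near : Fin n → Fin n → Bool
  near x y = ⌊ x Fin.≟ y ⌋ ∨ adj G x y

  differs : Fin n → Fin n → Fin n → Bool
  differs r b v = near r v xor near b v

  -- The size of the symmetric difference of N[r] ∩ S and N[b] ∩ S. Being a sum over vertices, it
  -- fits both the double counting below and evaluation by a fold.
  distance : Subset n → Fin n → Fin n → ℕ
  distance S r b = ∑[ v < n ] bit (lookup S v ∧ differs r b v)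

  lookup-N∩ : ∀ x S v → lookup (N[ G , x ] ∩ S) v ≡ near x v ∧ lookup S v
  lookup-N∩ x S v = trans (Vec.lookup-zipWith _∧_ v N[ G , x ] S)
                          (cong (_∧ lookup S v) (Vec.lookup∘tabulate (near x) v))

  distance≡0⇒≡ : ∀ S r b → distance S r b ≡ 0 → N[ G , r ] ∩ S ≡ N[ G , b ] ∩ S
  distance≡0⇒≡ S r b d≡0 = begin
    N[ G , r ] ∩ S                            ≡⟨ Vec.tabulate∘lookup _ ⟨
    Vec.tabulate (lookup (N[ G , r ] ∩ S))    ≡⟨ Vec.tabulate-cong agree ⟩
    Vec.tabulate (lookup (N[ G , b ] ∩ S))    ≡⟨ Vec.tabulate∘lookup _ ⟩
    N[ G , b ] ∩ S                            ∎
    where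
    open ≡-Reasoning
    ∧-agree : ∀ s x y → s ∧ (x xor y) ≡ false → x ∧ s ≡ y ∧ s
    ∧-agree true  x y eq = cong (_∧ true) (xor-false x y eq)
    ∧-agree false x y eq = trans (Bool.∧-zeroʳ x) (sym (Bool.∧-zeroʳ y))
    agree : ∀ v → lookup (N[ G , r ] ∩ S) v ≡ lookup (N[ G , b ] ∩ S) v
    agree v = trans (lookup-N∩ r S v) (trans
      (∧-agree (lookup S v) (near r v) (near b v)
        (bit≡0 (n≤0⇒n≡0 (subst (bit (lookup S v ∧ differs r b v) ≤_) d≡0
                 (term≤sum (λ v → bit (lookup S v ∧ differs r b v)) v)))))
      (sym (lookup-N∩ b S v)))

  ≡⇒distance≡0 : ∀ S r b → N[ G , r ] ∩ S ≡ N[ G , b ] ∩ S → distance S r b ≡ 0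
  ≡⇒distance≡0 S r b eq = sum-zero _ λ v → cong bit
    (agree (lookup S v) (near r v) (near b v)
      (trans (sym (lookup-N∩ r S v)) (trans (cong (λ p → lookup p v) eq) (lookup-N∩ b S v))))
    where
    agree : ∀ s x y → x ∧ s ≡ y ∧ s → s ∧ (x xor y) ≡ false
    agree false x     y     _ = refl
    agree true  true  true  _ = refl
    agree true  false false _ = refl

  module _ (c : Colouring n) where

    unseparated : Subset n → Fin n → Fin n → Bool
    unseparated S r b = isRed (c r) ∧ (not (isRed (c b)) ∧ (distance S r b ≡ᵇ 0))

    uncovered : Subset n → ℕ
    uncovered S = ∑[ r < n ] ∑[ b < n ] bit (unseparated S r b)

    gain : Subset n → Fin n → ℕ
    gain S v = ∑[ r < n ] ∑[ b < n ] bit (unseparated S r b ∧ differs r b v)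

    unseparated-elim : ∀ {S r b} → unseparated S r b ≡ true →
                       c r ≡ red × c b ≡ blue × distance S r b ≡ 0
    unseparated-elim eq with ∧-true eq
    ... | r-red , eq′ with ∧-true eq′
    ... | b-blue , d = isRed-true r-red , isRed-false b-blue , ≡ᵇ⇒≡ _ 0 (subst Bool.T (sym d) _)

    unseparated-intro : ∀ {S r b} → c r ≡ red → c b ≡ blue → distance S r b ≡ 0 →
                        unseparated S r b ≡ true
    unseparated-intro cr cb d rewrite cr | cb | d = refl

    uncovered≡0⇒separating : ∀ {S} → uncovered S ≡ 0 → RedBlueSeparating G c S
    uncovered≡0⇒separating {S} u≡0 r b cr cb eq = contradiction
      (≤-trans (≤-trans (≤-reflexive (cong bit (sym (unseparated-intro {S} cr cb (≡⇒distance≡0 S r b eq)))))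
                        (term≤sum (λ b → bit (unseparated S r b)) b))
        (≤-trans (term≤sum (λ r → ∑[ b < n ] bit (unseparated S r b)) r) (≤-reflexive u≡0)))
      λ ()

    -- Each unseparated pair is separated by some vertex of T.
    uncovered≤ : ∀ {T} → RedBlueSeparating G c T → ∀ S {g} → (∀ v → gain S v ≤ g) →
                 uncovered S ≤ ∣ T ∣ * g
    uncovered≤ {T} sep S {g} gain≤g = begin
      uncovered S
        ≤⟨ sum-mono-≤ (λ r → sum-mono-≤ (hit r)) ⟩
      ∑[ r < n ] ∑[ b < n ] ∑[ v < n ] (bit (lookup T v) * w v r b)
        ≡⟨ sum-cong-≗ (λ r → ∑-comm (λ b v → bit (lookup T v) * w v r b)) ⟩
      ∑[ r < n ] ∑[ v < n ] ∑[ b < n ] (bit (lookup T v) * w v r b)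
        ≡⟨ ∑-comm (λ r v → ∑[ b < n ] (bit (lookup T v) * w v r b)) ⟩
      ∑[ v < n ] ∑[ r < n ] ∑[ b < n ] (bit (lookup T v) * w v r b)
        ≡⟨ sum-cong-≗ (λ v → trans
             (sum-cong-≗ (λ r → sym (*-distribˡ-sum (bit (lookup T v)) (w v r))))
             (sym (*-distribˡ-sum (bit (lookup T v)) (λ r → sum (w v r))))) ⟩
      ∑[ v < n ] (bit (lookup T v) * gain S v)
        ≤⟨ sum-mono-≤ (λ v → *-monoʳ-≤ (bit (lookup T v)) (gain≤g v)) ⟩
      ∑[ v < n ] (bit (lookup T v) * g)
        ≡⟨ *-distribʳ-sum g (bit ∘ lookup T) ⟨
      ∑[ v < n ] bit (lookup T v) * g
        ≡⟨ cong (_* g) (∣S∣≡sum T) ⟨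
      ∣ T ∣ * g ∎
      where
      open ≤-Reasoning
      w : Fin n → Fin n → Fin n → ℕ
      w v r b = bit (unseparated S r b ∧ differs r b v)
      bit-∧ : ∀ x y → bit (x ∧ y) ≡ bit x * bit y
      bit-∧ true  y = sym (+-identityʳ (bit y))
      bit-∧ false y = refl
      hit : ∀ r b → bit (unseparated S r b) ≤ ∑[ v < n ] (bit (lookup T v) * w v r b)
      hit r b with unseparated S r b in eq
      ... | false = z≤n
      ... | true with unseparated-elim {S} eq
      -- Once `unseparated S r b` is true, the sum over v is `distance T r b`, which is positive
      -- because T separates the pair.
      ...   | cr , cb , _ = ≤-trans
        (n≢0⇒n>0 λ d≡0 → sep r b cr cb (distance≡0⇒≡ T r b d≡0))
        (≤-reflexive (sum-cong-≗ λ v → bit-∧ (lookup T v) (differs r b v)))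

    -- Holds pair by pair. A pair that v tells apart is separated once v is inserted, so it cannot
    -- count in both terms on the left; and insertion undoes no separation, so a pair uncovered
    -- afterwards was uncovered before.
    uncovered-insert : ∀ S v → uncovered (S [ v ]≔ inside) + gain S v ≤ uncovered S
    uncovered-insert S v = begin
      uncovered S′ + gain S v
        ≡⟨ ∑-distrib-+ (λ r → ∑[ b < n ] bit (unseparated S′ r b)) _ ⟨
      ∑[ r < n ] (∑[ b < n ] bit (unseparated S′ r b) + ∑[ b < n ] bit (unseparated S r b ∧ differs r b v))
        ≡⟨ sum-cong-≗ (λ r → sym (∑-distrib-+ (λ b → bit (unseparated S′ r b)) _)) ⟩
      ∑[ r < n ] ∑[ b < n ] (bit (unseparated S′ r b) + bit (unseparated S r b ∧ differs r b v))
        ≤⟨ sum-mono-≤ (λ r → sum-mono-≤ (split r)) ⟩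
      uncovered S ∎
      where
      open ≤-Reasoning
      S′ = S [ v ]≔ inside
      ⊆-insert : ∀ w → lookup S w ≡ true → lookup S′ w ≡ true
      ⊆-insert w S∋w with w Fin.≟ v
      ... | yes refl = Vec.lookup∘updateAt w S
      ... | no  w≢v  = trans (Vec.lookup∘updateAt′ w v w≢v S) S∋w
      distance-mono : ∀ r b → distance S r b ≤ distance S′ r b
      distance-mono r b = sum-mono-≤ λ w → bit-mono λ eq →
        cong₂ _∧_ (⊆-insert w (proj₁ (∧-true eq))) (proj₂ (∧-true {lookup S w} eq))
      split : ∀ r b → bit (unseparated S′ r b) + bit (unseparated S r b ∧ differs r b v)
                    ≤ bit (unseparated S r b)
      split r b with unseparated S′ r b in eq
      ... | false = bit-mono (proj₁ ∘ ∧-true)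
      ... | true with unseparated-elim {S′} eq
      ...   | cr , cb , d′≡0 rewrite
        unseparated-intro {S} cr cb (n≤0⇒n≡0 (subst (distance S r b ≤_) d′≡0 (distance-mono r b)))
        | bit≡0 {differs r b v} (n≤0⇒n≡0 (subst₂ _≤_
            (cong (λ x → bit (x ∧ differs r b v)) (Vec.lookup∘updateAt v S)) d′≡0
            (term≤sum (λ w → bit (lookup S′ w ∧ differs r b w)) v)))
        = ≤-refl

    -- Uncovered pairs lie in the product of the two colour classes, whose sizes add up to n.
    4*uncovered≤n² : ∀ S → 4 * uncovered S ≤ n * n
    4*uncovered≤n² S = begin
      4 * uncovered S
        ≤⟨ *-monoʳ-≤ 4 (sum-mono-≤ λ r → sum-mono-≤ (bound r)) ⟩
      4 * ∑[ r < n ] ∑[ b < n ] (x r * y b)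
        ≡⟨ cong (4 *_) (trans (sum-cong-≗ λ r → sym (*-distribˡ-sum (x r) y))
                              (sym (*-distribʳ-sum (sum y) x))) ⟩
      4 * (sum x * sum y)
        ≤⟨ 4mn≤[m+n]² (sum x) (sum y) ⟩
      (sum x + sum y) * (sum x + sum y)
        ≡⟨ cong (λ k → k * k) (trans (sym (∑-distrib-+ x y)) (trans (sum-cong-≗ one) (sum-one n))) ⟩
      n * n ∎
      where
      open ≤-Reasoning
      x y : Fin n → ℕ
      x r = bit (isRed (c r))
      y b = bit (not (isRed (c b)))
      one : ∀ v → x v + y v ≡ 1
      one v with isRed (c v)
      ... | true  = refl
      ... | false = refl
      bound : ∀ r b → bit (unseparated S r b) ≤ x r * y b
      bound r b with isRed (c r) | isRed (c b)
      ... | true  | false = bit-mono λ _ → refl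
      ... | true  | true  = z≤n
      ... | false | _     = z≤n

-- Terms with bounded iteration on the RAM

-- Terms of a small functional language.  fold z b iterates b over i < n,
-- where n is input cell 0; in b, variable 0 is i and variable 1 the accumulator.
data Term (v : ℕ) : Set where
  lit       : ℕ → Term v
  var       : Fin v → Term v
  inp cell  : Term v → Term v
  _⊞_ _⊟_   : Term v → Term v → Term v
  cond      : Term v → Term v → Term v → Term v
  fold      : Term v → Term (2 + v) → Term v

infixl 6 _⊞_ _⊟_

ifNonzero : ℕ → ℕ → ℕ → ℕ
ifNonzero zero    a b = b
ifNonzero (suc _) a b = a

-- The index runs upwards like the counter of the machine, and shifting the body by `suc` lets later
-- inductions follow the recursion on `Fin`.
iterate : ℕ → (ℕ → ℕ → ℕ) → ℕ → ℕ
iterate zero    f z = z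
iterate (suc k) f z = iterate k (f ∘ suc) (f 0 z)

⟦_⟧ : ∀ {v} → Term v → List ℕ → (ℕ → ℕ) → Vec ℕ v → ℕ
⟦ lit c ⟧      xs M ρ = c
⟦ var x ⟧      xs M ρ = lookup ρ x
⟦ inp e ⟧      xs M ρ = xs ‼ ⟦ e ⟧ xs M ρ
⟦ cell e ⟧     xs M ρ = M (⟦ e ⟧ xs M ρ)
⟦ e ⊞ e′ ⟧     xs M ρ = ⟦ e ⟧ xs M ρ + ⟦ e′ ⟧ xs M ρ
⟦ e ⊟ e′ ⟧     xs M ρ = ⟦ e ⟧ xs M ρ ∸ ⟦ e′ ⟧ xs M ρ
⟦ cond e a b ⟧ xs M ρ = ifNonzero (⟦ e ⟧ xs M ρ) (⟦ a ⟧ xs M ρ) (⟦ b ⟧ xs M ρ)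
⟦ fold z b ⟧   xs M ρ = iterate (xs ‼ 0) (λ i a → ⟦ b ⟧ xs M (i ∷ a ∷ ρ)) (⟦ z ⟧ xs M ρ)

-- compile e l k leaves the value of e in register k and writes to no register
-- below k; l holds the registers of the variables.
mutual
  compile : ∀ {v} → Term v → Vec ℕ v → ℕ → Program
  compile (lit c)      l k = k := const c
  compile (var x)      l k = k := reg (lookup l x)
  compile (inp e)      l k = compile e l k ⨾ k := input (reg k)
  compile (cell e)     l k = compile e l k ⨾ k := mem (reg k)
  compile (e ⊞ e′)     l k = compile e l k ⨾ compile e′ l (suc k) ⨾ k := reg k ⊕ reg (suc k)
  compile (e ⊟ e′)     l k = compile e l k ⨾ compile e′ l (suc k) ⨾ k := reg k ⊖ reg (suc k)
  compile (cond e a b) l k = compile e l k ⨾ ifnz reg k then compile a l k else compile b l k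
  -- Register k is the accumulator and k + 1 the index, so the body works from k + 2 on. The test n
  -- ∸ i is nonzero exactly while i < n.
  compile (fold z b)   l k =
    compile z l k ⨾ suc k := const 0 ⨾ whilenz input (const 0) ⊖ reg (suc k) loop foldBody b l k

  foldBody : ∀ {v} → Term (2 + v) → Vec ℕ v → ℕ → Program
  foldBody b l k =
    compile b (suc k ∷ k ∷ l) (2 + k) ⨾ k := reg (2 + k) ⨾ suc k := reg (suc k) ⊕ const 1

-- A bound on the running time when input cell 0 holds at most L.
time : ∀ {v} → Term v → ℕ → ℕ
time (lit c)      L = 2
time (var x)      L = 2
time (inp e)      L = time e L + 3
time (cell e)     L = time e L + 3
time (e ⊞ e′)     L = time e L + (time e′ L + 4)
time (e ⊟ e′)     L = time e L + (time e′ L + 4)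
time (cond e a b) L = time e L + (2 + (time a L + time b L))
-- 2 is the cost of clearing the index, the first 5 that of a loop test, 6 that of the two
-- assignments ending the body, and the last 5 that of the failing test.
time (fold z b)   L = time z L + (2 + (L * (5 + (time b L + 6)) + 5))

[↦]-same : ∀ f k v → (f [ k ↦ v ]) k ≡ v
[↦]-same f k v with k ≡ᵇ k in eq
... | true  = refl
... | false = contradiction (subst Bool.T eq (≡⇒≡ᵇ k k refl)) λ ()

[↦]-other : ∀ f k v {i} → i ≢ k → (f [ k ↦ v ]) i ≡ f i
[↦]-other f k v {i} i≢k with i ≡ᵇ k in eq
... | true  = contradiction (≡ᵇ⇒≡ i k (subst Bool.T (sym eq) _)) i≢k
... | false = refl

-- A frame condition: below k lie the variables and the pending intermediate values, and compiled
-- terms only read the memory.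
Preserves : ℕ → State → State → Set
Preserves k s s′ = (∀ i → i < k → regs s′ i ≡ regs s i) × memory s′ ≡ memory s

Preserves-weaken : ∀ {k k′ s s′} → k ≤ k′ → Preserves k′ s s′ → Preserves k s s′
Preserves-weaken k≤k′ (f , m) = (λ i i<k → f i (<-≤-trans i<k k≤k′)) , m

Preserves-trans : ∀ {k k′ s s′ s″} → k ≤ k′ →
                  Preserves k s s′ → Preserves k′ s′ s″ → Preserves k s s″
Preserves-trans k≤k′ (f , m) (f′ , m′) =
  (λ i i<k → trans (f′ i (<-≤-trans i<k k≤k′)) (f i i<k)) , trans m′ m

Preserves-assign : ∀ {k i v} s → k ≤ i → Preserves k s ⟨ regs s [ i ↦ v ] , memory s ⟩
Preserves-assign {k} {i} {v} s k≤i =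
  (λ j j<k → [↦]-other (regs s) i v (<⇒≢ (<-≤-trans j<k k≤i))) , refl

record Holds {v} (l ρ : Vec ℕ v) (k : ℕ) (s : State) : Set where
  constructor holds
  field
    held : ∀ x → lookup l x < k × regs s (lookup l x) ≡ lookup ρ x

open Holds

Holds-preserved : ∀ {v} {l ρ : Vec ℕ v} {k k′ s s′} → k ≤ k′ →
                  Preserves k s s′ → Holds l ρ k s → Holds l ρ k′ s′
Holds-preserved k≤k′ (f , _) h = holds λ x →
  <-≤-trans (proj₁ (held h x)) k≤k′ , trans (f _ (proj₁ (held h x))) (proj₂ (held h x))

Computes : List ℕ → Program → State → ℕ → ℕ → ℕ → Set
Computes xs p s k w t₀ = ∃₂ λ s′ t →
  (xs ⊢ p , s ⇓ s′ [ t ]) × t ≤ t₀ × regs s′ k ≡ w × Preserves k s s′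

fold-step : ∀ {xs k w p t₁ t₀} s s₁ → xs ⊢ p , s ⇓ s₁ [ t₁ ] → t₁ ≤ t₀ →
  regs s₁ (2 + k) ≡ w → Preserves (2 + k) s s₁ →
  ∃₂ λ s₂ t → (xs ⊢ p ⨾ k := reg (2 + k) ⨾ suc k := reg (suc k) ⊕ const 1 , s ⇓ s₂ [ t ])
            × t ≤ t₀ + 6 × regs s₂ k ≡ w × regs s₂ (suc k) ≡ suc (regs s (suc k))
            × Preserves k s s₂
fold-step {k = k} {w} s s₁ run t≤ v p =
  _ , _ , seq run (seq assign assign) , +-monoˡ-≤ 6 t≤ ,
  trans ([↦]-other r₁ (suc k) _ (<⇒≢ (n<1+n k))) (trans ([↦]-same (regs s₁) k _) v) ,
  trans ([↦]-same r₁ (suc k) _)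
        (trans (cong (_+ 1) (trans ([↦]-other (regs s₁) k _ 1+n≢n) (proj₁ p (suc k) ≤-refl)))
               (+-comm _ 1)) ,
  Preserves-trans ≤-refl
    (Preserves-trans ≤-refl (Preserves-weaken (m≤n+m k 2) p) (Preserves-assign s₁ ≤-refl))
    (Preserves-assign ⟨ r₁ , memory s₁ ⟩ (n≤1+n k))
  where
  r₁ = regs s₁ [ k ↦ regs s₁ (2 + k) ]

mutual
  -- By induction on the term. The second operand is compiled at k + 1, so the first value survives
  -- in register k. Since memory is unchanged, the denotations of later subterms may be taken at the
  -- starting state.
  compile-correct : ∀ {v} (e : Term v) {xs L l ρ k s} → xs ‼ 0 ≤ L → Holds l ρ k s →
    Computes xs (compile e l k) s k (⟦ e ⟧ xs (memory s) ρ) (time e L)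
  compile-correct (lit c) {k = k} {s} n≤L h =
    _ , _ , assign , ≤-refl , [↦]-same (regs s) k c , Preserves-assign s ≤-refl
  compile-correct (var x) {l = l} {k = k} {s} n≤L h =
    _ , _ , assign , ≤-refl ,
    trans ([↦]-same (regs s) k (regs s (lookup l x))) (proj₂ (held h x)) , Preserves-assign s ≤-refl
  compile-correct (inp e) {xs} {k = k} n≤L h with compile-correct e n≤L h
  ... | s₁ , _ , run₁ , t₁≤ , v₁ , p₁ =
    _ , _ , seq run₁ assign , +-monoˡ-≤ 3 t₁≤ ,
    trans ([↦]-same (regs s₁) k _) (cong (xs ‼_) v₁) ,
    Preserves-trans ≤-refl p₁ (Preserves-assign s₁ ≤-refl)
  compile-correct (cell e) {k = k} n≤L h with compile-correct e n≤L h
  ... | s₁ , _ , run₁ , t₁≤ , v₁ , p₁ =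
    _ , _ , seq run₁ assign , +-monoˡ-≤ 3 t₁≤ ,
    trans ([↦]-same (regs s₁) k _) (cong₂ _$_ (proj₂ p₁) v₁) ,
    Preserves-trans ≤-refl p₁ (Preserves-assign s₁ ≤-refl)
  compile-correct (e ⊞ e′) {xs} {ρ = ρ} {k} n≤L h with compile-correct e n≤L h
  ... | s₁ , _ , run₁ , t₁≤ , v₁ , p₁
    with compile-correct e′ {k = suc k} n≤L (Holds-preserved (n≤1+n k) p₁ h)
  ... | s₂ , _ , run₂ , t₂≤ , v₂ , p₂ =
    _ , _ , seq run₁ (seq run₂ assign) , +-mono-≤ t₁≤ (+-monoˡ-≤ 4 t₂≤) ,
    trans ([↦]-same (regs s₂) k _)
      (cong₂ _+_ (trans (proj₁ p₂ k ≤-refl) v₁)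
                 (trans v₂ (cong (λ M → ⟦ e′ ⟧ xs M ρ) (proj₂ p₁)))) ,
    Preserves-trans ≤-refl (Preserves-trans (n≤1+n k) p₁ p₂) (Preserves-assign s₂ ≤-refl)
  compile-correct (e ⊟ e′) {xs} {ρ = ρ} {k} n≤L h with compile-correct e n≤L h
  ... | s₁ , _ , run₁ , t₁≤ , v₁ , p₁
    with compile-correct e′ {k = suc k} n≤L (Holds-preserved (n≤1+n k) p₁ h)
  ... | s₂ , _ , run₂ , t₂≤ , v₂ , p₂ =
    _ , _ , seq run₁ (seq run₂ assign) , +-mono-≤ t₁≤ (+-monoˡ-≤ 4 t₂≤) ,
    trans ([↦]-same (regs s₂) k _)
      (cong₂ _∸_ (trans (proj₁ p₂ k ≤-refl) v₁)
                 (trans v₂ (cong (λ M → ⟦ e′ ⟧ xs M ρ) (proj₂ p₁)))) ,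
    Preserves-trans ≤-refl (Preserves-trans (n≤1+n k) p₁ p₂) (Preserves-assign s₂ ≤-refl)
  compile-correct (cond e a b) {xs} {L} {ρ = ρ} {k} {s} n≤L h with compile-correct e {ρ = ρ} n≤L h
  ... | s₁ , _ , run₁ , t₁≤ , v₁ , p₁ with ⟦ e ⟧ xs (memory s) ρ in eq
  ... | zero with compile-correct b n≤L (Holds-preserved ≤-refl p₁ h)
  ...   | s₂ , _ , run₂ , t₂≤ , v₂ , p₂ =
    _ , _ , seq run₁ (if-zero (trans v₁ eq) run₂) ,
    +-mono-≤ t₁≤ (+-monoʳ-≤ 2 (≤-trans t₂≤ (m≤n+m _ (time a L)))) ,
    trans v₂ (cong (λ M → ⟦ b ⟧ xs M ρ) (proj₂ p₁)) , Preserves-trans ≤-refl p₁ p₂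
  compile-correct (cond e a b) {xs} {L} {ρ = ρ} {k} {s} n≤L h | s₁ , _ , run₁ , t₁≤ , v₁ , p₁ | suc _
    with compile-correct a n≤L (Holds-preserved ≤-refl p₁ h)
  ...   | s₂ , _ , run₂ , t₂≤ , v₂ , p₂ =
    _ , _ , seq run₁ (if-nonzero (λ z → 1+n≢0 (trans (sym eq) (trans (sym v₁) z))) run₂) ,
    +-mono-≤ t₁≤ (+-monoʳ-≤ 2 (≤-trans t₂≤ (m≤m+n _ _))) ,
    trans v₂ (cong (λ M → ⟦ a ⟧ xs M ρ) (proj₂ p₁)) , Preserves-trans ≤-refl p₁ p₂
  compile-correct (fold z b) {xs} {L} {l} {ρ} {k} {s} n≤L h with compile-correct z n≤L h
  ... | s₁ , _ , run₁ , t₁≤ , v₁ , p₁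
    with loop-correct b {s = ⟨ regs s₁ [ suc k ↦ 0 ] , memory s₁ ⟩} _ (xs ‼ 0) 0 n≤L
           (Holds-preserved ≤-refl (Preserves-trans ≤-refl p₁ (Preserves-assign s₁ (n≤1+n k))) h)
           ([↦]-same (regs s₁) (suc k) 0) (+-identityʳ _) (λ _ _ → refl)
  ... | s₂ , _ , run₂ , t₂≤ , v₂ , p₂ =
    _ , _ , seq run₁ (seq assign run₂) ,
    +-mono-≤ t₁≤ (+-monoʳ-≤ 2 (≤-trans t₂≤ (+-monoˡ-≤ 5 (*-monoˡ-≤ _ n≤L)))) ,
    trans v₂ (cong₂ (λ M a → iterate (xs ‼ 0) (λ i a → ⟦ b ⟧ xs M (i ∷ a ∷ ρ)) a) (proj₂ p₁)
               (trans ([↦]-other (regs s₁) (suc k) 0 (<⇒≢ (n<1+n k))) v₁)) ,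
    Preserves-trans ≤-refl (Preserves-trans ≤-refl p₁ (Preserves-assign s₁ (n≤1+n k))) p₂

  -- Generalised to a loop entered at index j with m = n - j iterations left. `f` is the body as a
  -- function of the offset from j, tied to the term only pointwise because passing to j + 1
  -- rewrites j + (i + 1) as (j + 1) + i.
  loop-correct : ∀ {v} (b : Term (2 + v)) {xs L l ρ k s} f m j → xs ‼ 0 ≤ L → Holds l ρ k s →
    regs s (suc k) ≡ j → m + j ≡ xs ‼ 0 →
    (∀ i a → ⟦ b ⟧ xs (memory s) (j + i ∷ a ∷ ρ) ≡ f i a) →
    Computes xs (whilenz input (const 0) ⊖ reg (suc k) loop foldBody b l k) s k
      (iterate m f (regs s k)) (m * (5 + (time b L + 6)) + 5)
  loop-correct b f zero j n≤L h r eq f≡ =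
    _ , _ , while-zero (trans (cong₂ _∸_ (sym eq) r) (n∸n≡0 j)) , ≤-refl , refl ,
    (λ _ _ → refl) , refl
  loop-correct b {xs} {L} {l} {ρ} {k} {s} f (suc m) j n≤L h r eq f≡
    with compile-correct b {l = suc k ∷ k ∷ l} {j ∷ regs s k ∷ ρ} {2 + k} {s} n≤L
           (holds λ { zero          → ≤-refl , r
                    ; (suc zero)    → n≤1+n _ , refl
                    ; (suc (suc x)) → ≤-trans (proj₁ (held h x)) (m≤n+m k 2) , proj₂ (held h x) })
  ... | s₁ , _ , run₁ , t₁≤ , v₁ , p₁ with fold-step s s₁ run₁ t₁≤ v₁ p₁
  ... | s₂ , _ , run₂ , t₂≤ , v₂ , r₂ , p₂
    with loop-correct b (f ∘ suc) m (suc j) n≤L (Holds-preserved ≤-refl p₂ h)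
           (trans r₂ (cong suc r)) (trans (+-suc m j) eq)
           (λ i a → trans (cong₂ (λ M i → ⟦ b ⟧ xs M (i ∷ a ∷ ρ)) (proj₂ p₂) (sym (+-suc j i)))
                          (f≡ (suc i) a))
  ... | s₃ , _ , run₃ , t₃≤ , v₃ , p₃ =
    _ , _ ,
    while-nonzero (λ z → <⇒≱ (subst (j <_) eq (s≤s (m≤n+m j m)))
                             (subst (xs ‼ 0 ≤_) r (m∸n≡0⇒m≤n z))) run₂ run₃ ,
    ≤-trans (+-mono-≤ (+-monoʳ-≤ 5 t₂≤) t₃≤)
            (≤-reflexive (sym (+-assoc (5 + (time b L + 6)) _ 5))) ,
    trans v₃ (cong (iterate m (f ∘ suc))
      (trans v₂ (trans (cong (λ i → ⟦ b ⟧ xs (memory s) (i ∷ regs s k ∷ ρ)) (sym (+-identityʳ j)))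
                       (f≡ 0 _)))) ,
    Preserves-trans ≤-refl p₂ p₃

-- The greedy algorithm

length-concat-tabulate : ∀ {A : Set} m {n} (f : Fin m → Fin n → A) →
  length (concat (tabulate λ x → tabulate (f x))) ≡ m * n
length-concat-tabulate zero    f = refl
length-concat-tabulate (suc m) f =
  trans (List.length-++ (tabulate (f zero)))
        (cong₂ _+_ (List.length-tabulate (f zero)) (length-concat-tabulate m (f ∘ suc)))

length-encodeInstance : ∀ {n} (G : Graph n) c → length (encodeInstance G c) ≡ suc (n + n * n)
length-encodeInstance {n} G c = cong suc (trans (List.length-++ (tabulate (encodeColour ∘ c)))
  (cong₂ _+_ (List.length-tabulate (encodeColour ∘ c))
             (length-concat-tabulate n (λ x y → bit (adj G x y)))))

‼-tabulate : ∀ {n} (f : Fin n → ℕ) ys i → (tabulate f ++ ys) ‼ toℕ i ≡ f i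
‼-tabulate f ys zero    = refl
‼-tabulate f ys (suc i) = ‼-tabulate (f ∘ suc) ys i

‼-++ : ∀ {n} (f : Fin n → ℕ) ys j → (tabulate f ++ ys) ‼ (n + j) ≡ ys ‼ j
‼-++ {zero}  f ys j = refl
‼-++ {suc n} f ys j = ‼-++ (f ∘ suc) ys j

‼-concat-tabulate : ∀ {m n} (f : Fin m → Fin n → ℕ) x y →
  concat (tabulate λ x → tabulate (f x)) ‼ (toℕ x * n + toℕ y) ≡ f x y
‼-concat-tabulate {suc m} f zero    y = ‼-tabulate (f zero) _ y
‼-concat-tabulate {suc m} {n} f (suc x) y =
  trans (cong (concat (tabulate (tabulate ∘ f)) ‼_) (+-assoc n (toℕ x * n) (toℕ y)))
        (trans (‼-++ (f zero) (concat (tabulate (tabulate ∘ f ∘ suc))) (toℕ x * n + toℕ y))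
               (‼-concat-tabulate (f ∘ suc) x y))

encodeSubset-lookup : ∀ {n} (S : Subset n) (M : ℕ → ℕ) →
  (∀ w → M (toℕ w) ≡ bit (lookup S w)) →
  ∀ i → M (toℕ i) ≡ List.lookup (encodeSubset S) i
encodeSubset-lookup (x ∷ S) M eq zero    = eq zero
encodeSubset-lookup (x ∷ S) M eq (suc i) = encodeSubset-lookup S (M ∘ suc) (eq ∘ suc) i

iterate-const : ∀ k x z → iterate k (λ _ a → a + x) z ≡ z + k * x
iterate-const zero    x z = sym (+-identityʳ z)
iterate-const (suc k) x z = trans (iterate-const k x (z + x)) (+-assoc z x (k * x))

iterate-sum : ∀ n (h : ℕ → ℕ → ℕ) (g : Fin n → ℕ) → (∀ i a → h (toℕ i) a ≡ a + g i) →
              ∀ z → iterate n h z ≡ z + sum g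
iterate-sum zero    h g eq z = sym (+-identityʳ z)
iterate-sum (suc n) h g eq z =
  trans (iterate-sum n (h ∘ suc) (g ∘ suc) (eq ∘ suc) (h 0 z))
        (trans (cong (_+ sum (g ∘ suc)) (eq zero z)) (+-assoc z (g zero) _))

-- The truncated difference serves as the comparison: a nonzero value replaces the candidate. `e`
-- lists the indices still to be visited, so the induction can shorten this list while the candidate
-- keeps ranging over all of `Fin m`.
iterate-argmax : ∀ {m} k (h : ℕ → ℕ → ℕ) (g : Fin m → ℕ) (e : Fin k → Fin m) →
  (∀ i x → h (toℕ i) (toℕ x) ≡ ifNonzero (g (e i) ∸ g x) (toℕ (e i)) (toℕ x)) →
  ∀ x → ∃ λ y → iterate k h (toℕ x) ≡ toℕ y × g x ≤ g y × (∀ i → g (e i) ≤ g y)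
iterate-argmax zero    h g e eq x = x , refl , ≤-refl , λ ()
iterate-argmax (suc k) h g e eq x with g (e zero) ∸ g x in d | eq zero x
... | zero  | step with iterate-argmax k (h ∘ suc) g (e ∘ suc) (eq ∘ suc) x
...   | y , it , x≤y , max = y , trans (cong (iterate k (h ∘ suc)) step) it , x≤y ,
        λ { zero → ≤-trans (m∸n≡0⇒m≤n d) x≤y ; (suc i) → max i }
iterate-argmax (suc k) h g e eq x | suc _ | step
  with iterate-argmax k (h ∘ suc) g (e ∘ suc) (eq ∘ suc) (e zero)
...   | y , it , e≤y , max = y , trans (cong (iterate k (h ∘ suc)) step) it ,
        ≤-trans (<⇒≤ (m∸n≢0⇒n<m (λ z → 1+n≢0 (trans (sym d) z)))) e≤y ,
        λ { zero → e≤y ; (suc i) → max i }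

-- Terms for the quantities of a greedy round

andT : ∀ {v} → Term v → Term v → Term v
andT a b = cond a b (lit 0)

notT : ∀ {v} → Term v → Term v
notT a = cond a (lit 0) (lit 1)

-- The body of sumT refers to the index as variable 0 and must skip variable 1.
sumT : ∀ {v} → Term (2 + v) → Term v
sumT b = fold (lit 0) (var 1F ⊞ b)

-- x * n, as input cell 0 holds n
scaleT : ∀ {v} → Fin v → Term v
scaleT x = sumT (var (suc (suc x)))

colourT : ∀ {v} → Fin v → Term v
colourT x = inp (lit 1 ⊞ var x)

adjT : ∀ {v} → Fin v → Fin v → Term v
adjT x y = inp (lit 1 ⊞ (inp (lit 0) ⊞ (scaleT x ⊞ var y)))

-- Equality of two vertices is the vanishing of both truncated differences.
nearT : ∀ {v} → Fin v → Fin v → Term v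
nearT x y = cond (var x ⊟ var y) (adjT x y) (cond (var y ⊟ var x) (adjT x y) (lit 1))

differsT : ∀ {v} → Fin v → Fin v → Fin v → Term v
differsT r b w = cond (nearT r w) (notT (nearT b w)) (nearT b w)

unseparatedT : ∀ {v} → Fin v → Fin v → Term v
unseparatedT r b = andT (colourT r) (andT (notT (colourT b))
  (notT (sumT (andT (cell (var 0F)) (differsT (suc (suc r)) (suc (suc b)) 0F)))))

uncoveredT : ∀ {v} → Term v
uncoveredT = sumT (sumT (unseparatedT 2F 0F))

gainT : ∀ {v} → Fin v → Term v
gainT x = sumT (sumT (andT (unseparatedT 2F 0F) (differsT 2F 0F (suc (suc (suc (suc x)))))))

-- The initial candidate 0 is a vertex whenever a pair is uncovered, since then n ≥ 1.
pickT : ∀ {v} → Term v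
pickT = fold (lit 0) (cond (gainT 0F ⊟ gainT 1F) (var 0F) (var 1F))

ifNonzero-and : ∀ x y → ifNonzero (bit x) (bit y) 0 ≡ bit (x ∧ y)
ifNonzero-and true  y = refl
ifNonzero-and false y = refl

ifNonzero-not : ∀ x → ifNonzero (bit x) 0 1 ≡ bit (not x)
ifNonzero-not true  = refl
ifNonzero-not false = refl

ifNonzero-xor : ∀ x y → ifNonzero (bit x) (bit (not y)) (bit y) ≡ bit (x xor y)
ifNonzero-xor true  y = refl
ifNonzero-xor false y = refl

ifNonzero-≡ᵇ0 : ∀ k → ifNonzero k 0 1 ≡ bit (k ≡ᵇ 0)
ifNonzero-≡ᵇ0 zero    = refl
ifNonzero-≡ᵇ0 (suc _) = refl

ifNonzero-≟ : ∀ {n} (x y : Fin n) k →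
  ifNonzero (toℕ x ∸ toℕ y) (bit k) (ifNonzero (toℕ y ∸ toℕ x) (bit k) 1) ≡ bit (⌊ x Fin.≟ y ⌋ ∨ k)
ifNonzero-≟ x y k with x Fin.≟ y
... | yes refl rewrite n∸n≡0 (toℕ x) = refl
... | no  x≢y with toℕ x ∸ toℕ y in xy | toℕ y ∸ toℕ x in yx
...   | suc _ | _     = refl
...   | zero  | suc _ = refl
...   | zero  | zero  =
  contradiction (Fin.toℕ-injective (≤-antisym (m∸n≡0⇒m≤n xy) (m∸n≡0⇒m≤n yx))) x≢y

cong-ifNonzero : ∀ {k k′ a a′ b b′} → k ≡ k′ → a ≡ a′ → b ≡ b′ →
                 ifNonzero k a b ≡ ifNonzero k′ a′ b′
cong-ifNonzero refl refl refl = refl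

-- The representation coincides with the output format, so the final memory needs no conversion.
record Represents {n : ℕ} (M : ℕ → ℕ) (S : Subset n) : Set where
  constructor represents
  field
    represented : ∀ w → M (toℕ w) ≡ bit (lookup S w)

open Represents public

Represents-insert : ∀ {n M} {S : Subset n} v → Represents M S →
                    Represents (M [ toℕ v ↦ 1 ]) (S [ v ]≔ inside)
Represents-insert {M = M} {S} v rep = represents inserted
  where
  inserted : ∀ w → (M [ toℕ v ↦ 1 ]) (toℕ w) ≡ bit (lookup (S [ v ]≔ inside) w)
  inserted w with w Fin.≟ v
  ... | yes refl = trans ([↦]-same M (toℕ w) 1) (cong bit (sym (Vec.lookup∘updateAt w S)))
  ... | no  w≢v  = trans ([↦]-other M (toℕ v) 1 (w≢v ∘ Fin.toℕ-injective))
                         (trans (represented rep w) (cong bit (sym (Vec.lookup∘updateAt′ w v w≢v S))))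

module _ {n : ℕ} (G : Graph n) (c : Colouring n) (M : ℕ → ℕ) where

  record Denotes {v : ℕ} (e : Term v) (ρ : Vec ℕ v) (k : ℕ) : Set where
    constructor denotes
    field
      denotation : ⟦ e ⟧ (encodeInstance G c) M ρ ≡ k

  open Denotes public

  andT-denotes : ∀ {v} {a b : Term v} {ρ x y} →
    Denotes a ρ (bit x) → Denotes b ρ (bit y) → Denotes (andT a b) ρ (bit (x ∧ y))
  andT-denotes {x = x} {y} (denotes a) (denotes b) =
    denotes (trans (cong-ifNonzero a b refl) (ifNonzero-and x y))

  notT-denotes : ∀ {v} {a : Term v} {ρ x} → Denotes a ρ (bit x) → Denotes (notT a) ρ (bit (not x))
  notT-denotes {x = x} (denotes a) = denotes (trans (cong-ifNonzero a refl refl) (ifNonzero-not x))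

  sumT-denotes : ∀ {v} {e : Term (2 + v)} {ρ} (g : Fin n → ℕ) →
    (∀ i a → Denotes e (toℕ i ∷ a ∷ ρ) (g i)) → Denotes (sumT e) ρ (sum g)
  sumT-denotes g e = denotes (iterate-sum n _ g (λ i a → cong (a +_) (denotation (e i a))) 0)

  colourT-denotes : ∀ {v} {x : Fin v} {ρ x′} → Denotes (var x) ρ (toℕ x′) →
    Denotes (colourT x) ρ (bit (isRed (c x′)))
  colourT-denotes {x′ = x′} (denotes x) = denotes (trans (cong (λ i → encodeInstance G c ‼ suc i) x)
    (trans (‼-tabulate (encodeColour ∘ c) _ x′) (encodeColour≡bit (c x′))))
    where
    encodeColour≡bit : ∀ k → encodeColour k ≡ bit (isRed k)
    encodeColour≡bit red  = refl
    encodeColour≡bit blue = refl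

  adjT-denotes : ∀ {v} {x y : Fin v} {ρ x′ y′} →
    Denotes (var x) ρ (toℕ x′) → Denotes (var y) ρ (toℕ y′) →
    Denotes (adjT x y) ρ (bit (adj G x′ y′))
  adjT-denotes {x′ = x′} {y′} (denotes x) (denotes y) = denotes (trans
    (cong₂ (λ i j → encodeInstance G c ‼ suc (n + (i + j)))
      (trans (iterate-const n _ 0) (trans (cong (n *_) x) (*-comm n (toℕ x′)))) y)
    (trans (‼-++ (encodeColour ∘ c) (concat (tabulate λ x → tabulate λ y → bit (adj G x y))) (toℕ x′ * n + toℕ y′))
           (‼-concat-tabulate (λ x y → bit (adj G x y)) x′ y′)))

  nearT-denotes : ∀ {v} {x y : Fin v} {ρ x′ y′} →
    Denotes (var x) ρ (toℕ x′) → Denotes (var y) ρ (toℕ y′) →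
    Denotes (nearT x y) ρ (bit (near G x′ y′))
  nearT-denotes {x′ = x′} {y′} dx@(denotes ex) dy@(denotes ey) = denotes (trans
    (cong-ifNonzero (cong₂ _∸_ ex ey) adj≡ (cong-ifNonzero (cong₂ _∸_ ey ex) adj≡ refl))
    (ifNonzero-≟ x′ y′ (adj G x′ y′)))
    where adj≡ = denotation (adjT-denotes dx dy)

  differsT-denotes : ∀ {v} {r b w : Fin v} {ρ r′ b′ w′} →
    Denotes (var r) ρ (toℕ r′) → Denotes (var b) ρ (toℕ b′) → Denotes (var w) ρ (toℕ w′) →
    Denotes (differsT r b w) ρ (bit (differs G r′ b′ w′))
  differsT-denotes {r′ = r′} {b′} {w′} r b w = denotes (trans
    (cong-ifNonzero (denotation (nearT-denotes r w))
      (denotation (notT-denotes (nearT-denotes b w))) (denotation (nearT-denotes b w)))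
    (ifNonzero-xor (near G r′ w′) (near G b′ w′)))

  module _ {S : Subset n} (rep : Represents M S) where

    unseparatedT-denotes : ∀ {v} {r b : Fin v} {ρ r′ b′} →
      Denotes (var r) ρ (toℕ r′) → Denotes (var b) ρ (toℕ b′) →
      Denotes (unseparatedT r b) ρ (bit (unseparated G c S r′ b′))
    unseparatedT-denotes {r = r} {b} {ρ} {r′} {b′} dr@(denotes er) db@(denotes eb) =
      andT-denotes (colourT-denotes dr) (andT-denotes (notT-denotes (colourT-denotes db))
        (denotes (trans (cong-ifNonzero (denotation distance-denotes) refl refl)
                        (ifNonzero-≡ᵇ0 (distance G S r′ b′)))))
      where
      distance-denotes : Denotes (sumT (andT (cell (var 0F)) (differsT (suc (suc r)) (suc (suc b)) 0F)))
                                 ρ (distance G S r′ b′)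
      distance-denotes = sumT-denotes _ λ w _ →
        andT-denotes (denotes (represented rep w)) (differsT-denotes (denotes er) (denotes eb) (denotes refl))

    uncoveredT-denotes : ∀ {v} (ρ : Vec ℕ v) → Denotes uncoveredT ρ (uncovered G c S)
    uncoveredT-denotes ρ = sumT-denotes _ λ r _ → sumT-denotes _ λ b _ →
      unseparatedT-denotes (denotes refl) (denotes refl)

    gainT-denotes : ∀ {v} {x : Fin v} {ρ x′} → Denotes (var x) ρ (toℕ x′) →
                    Denotes (gainT x) ρ (gain G c S x′)
    gainT-denotes (denotes x) = sumT-denotes _ λ r _ → sumT-denotes _ λ b _ →
      andT-denotes (unseparatedT-denotes (denotes refl) (denotes refl))
                   (differsT-denotes (denotes refl) (denotes refl) (denotes x))

    pickT-denotes : ∀ {v} (ρ : Vec ℕ v) (x : Fin n) → toℕ x ≡ 0 →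
      ∃ λ y → Denotes pickT ρ (toℕ y) × (∀ v → gain G c S v ≤ gain G c S y)
    pickT-denotes ρ x x≡0
      with iterate-argmax n _ (gain G c S) (λ i → i) (λ i x → cong-ifNonzero
             (cong₂ _∸_ (denotation (gainT-denotes {x = 0F} {toℕ i ∷ toℕ x ∷ ρ} (denotes refl)))
                        (denotation (gainT-denotes {x = 1F} {toℕ i ∷ toℕ x ∷ ρ} (denotes refl)))) refl refl) x
    ... | y , it , _ , max = y , denotes (trans (cong (iterate n _) (sym x≡0)) it) , max

-- Polynomial growth and the greedy program

PolynomiallyBounded : (ℕ → ℕ) → Set
PolynomiallyBounded f = ∃₂ λ a d → ∀ L → 1 ≤ L → f L ≤ a * L ^ d

poly-const : ∀ k → PolynomiallyBounded (λ _ → k)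
poly-const k = k , 0 , λ L _ → ≤-reflexive (sym (*-identityʳ k))

poly-+ : ∀ {f g} → PolynomiallyBounded f → PolynomiallyBounded g → PolynomiallyBounded (λ L → f L + g L)
-- The exponent d + e dominates both d and e; powers of L are monotone in the exponent because L ≥
-- 1.
poly-+ {f} {g} (a , d , f≤) (b , e , g≤) = a + b , d + e , λ L 1≤L → begin
  f L + g L                             ≤⟨ +-mono-≤ (f≤ L 1≤L) (g≤ L 1≤L) ⟩
  a * L ^ d + b * L ^ e                 ≤⟨ +-mono-≤ (*-monoʳ-≤ a (^-monoʳ-≤ L {{>-nonZero 1≤L}} (m≤m+n d e)))
                                                    (*-monoʳ-≤ b (^-monoʳ-≤ L {{>-nonZero 1≤L}} (m≤n+m e d))) ⟩
  a * L ^ (d + e) + b * L ^ (d + e)     ≡⟨ *-distribʳ-+ (L ^ (d + e)) a b ⟨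
  (a + b) * L ^ (d + e)                 ∎
  where open ≤-Reasoning

poly-L* : ∀ {f} → PolynomiallyBounded f → PolynomiallyBounded (λ L → L * f L)
poly-L* {f} (a , d , f≤) = a , suc d , λ L 1≤L →
  ≤-trans (*-monoʳ-≤ L (f≤ L 1≤L)) (≤-reflexive (swap L a (L ^ d)))
  where
  swap : ∀ L a p → L * (a * p) ≡ a * (L * p)
  swap = solve-∀

poly-time : ∀ {v} (e : Term v) → PolynomiallyBounded (time e)
poly-time (lit c)      = poly-const 2
poly-time (var x)      = poly-const 2
poly-time (inp e)      = poly-+ (poly-time e) (poly-const 3)
poly-time (cell e)     = poly-+ (poly-time e) (poly-const 3)
poly-time (e ⊞ e′)     = poly-+ (poly-time e) (poly-+ (poly-time e′) (poly-const 4))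
poly-time (e ⊟ e′)     = poly-+ (poly-time e) (poly-+ (poly-time e′) (poly-const 4))
poly-time (cond e a b) =
  poly-+ (poly-time e) (poly-+ (poly-const 2) (poly-+ (poly-time a) (poly-time b)))
poly-time (fold z b)   = poly-+ (poly-time z) (poly-+ (poly-const 2) (poly-+ (poly-L*
  (poly-+ (poly-const 5) (poly-+ (poly-time b) (poly-const 6)))) (poly-const 5)))

-- Abstract, since the type checker would otherwise unfold these closed terms.
abstract
  uncovered₀ pick₀ : Term 0
  uncovered₀ = uncoveredT
  pick₀ = pickT

  uncovered₀-denotes : ∀ {n} (G : Graph n) c M {S} → Represents M S →
    Denotes G c M uncovered₀ [] (uncovered G c S)
  uncovered₀-denotes G c M rep = uncoveredT-denotes G c M rep []

  pick₀-denotes : ∀ {n} (G : Graph n) c M {S} → Represents M S → (x : Fin n) → toℕ x ≡ 0 →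
    ∃ λ y → Denotes G c M pick₀ [] (toℕ y) × (∀ v → gain G c S v ≤ gain G c S y)
  pick₀-denotes G c M rep = pickT-denotes G c M rep []

-- Register 0 holds first the chosen vertex, used as the address to mark, and then the new number of
-- uncovered pairs, which is the loop test of `greedy`.
greedyRound : Program
greedyRound = compile pick₀ [] 0 ⨾ mem[ reg 0 ]:= const 1 ⨾ compile uncovered₀ [] 0

greedy : Program
greedy = compile uncovered₀ [] 0 ⨾ whilenz reg 0 loop greedyRound

roundTime : ℕ → ℕ
roundTime L = 2 + (time pick₀ L + (3 + time uncovered₀ L))

-- Every round covers a new pair and there are at most n² / 4 pairs, so the input length L bounds
-- the number of rounds. The final 2 is the failing test.
greedyTime : ℕ → ℕ
greedyTime L = time uncovered₀ L + (L * roundTime L + 2)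

poly-greedyTime : PolynomiallyBounded greedyTime
poly-greedyTime = poly-+ (poly-time uncovered₀) (poly-+ (poly-L* (poly-+ (poly-const 2)
  (poly-+ (poly-time pick₀) (poly-+ (poly-const 3) (poly-time uncovered₀))))) (poly-const 2))

-- State of the greedy algorithm after g rounds, where k is the optimum and m
-- the initial number of uncovered pairs.  The last field is the second one
-- before the last round, when at least one pair was still uncovered.
record Invariant (k m u g : ℕ) : Set where
  field
    decay    : k ^ g * u ≤ (k ∸ 1) ^ g * m
    previous : ∀ h → g ≡ suc h → 1 ≤ k × k ^ h ≤ (k ∸ 1) ^ h * m

open Invariant

invariant-initial : ∀ k m → Invariant k m m 0
invariant-initial k m = record { decay = ≤-refl ; previous = λ _ () }

-- The covering bound and the gain combine to k u′ ≤ (k - 1) u, one more factor of decay. As u ≥ 1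
-- when the round starts, the old `decay` with u dropped becomes the new `previous`; k = 0 would
-- force u = 0.
invariant-step : ∀ {k m u u′ x g} → u ≢ 0 → u ≤ k * x → u′ + x ≤ u →
                 Invariant k m u g → Invariant k m u′ (suc g)
invariant-step {zero} u≢0 u≤0 _ _ = contradiction (n≤0⇒n≡0 u≤0) u≢0
invariant-step {k@(suc j)} {m} {u} {u′} {x} {g} u≢0 u≤kx u′+x≤u inv = record
  { decay    = begin
      k ^ suc g * u′        ≡⟨ trans (cong (_* u′) (*-comm k (k ^ g))) (*-assoc (k ^ g) k u′) ⟩
      k ^ g * (k * u′)      ≤⟨ *-monoʳ-≤ (k ^ g) ku′≤ju ⟩
      k ^ g * (j * u)       ≡⟨ swap (k ^ g) j u ⟩
      j * (k ^ g * u)       ≤⟨ *-monoʳ-≤ j (decay inv) ⟩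
      j * (j ^ g * m)       ≡⟨ *-assoc j (j ^ g) m ⟨
      j ^ suc g * m         ∎
  ; previous = λ { _ refl → s≤s z≤n ,
      ≤-trans (m≤m*n (k ^ g) u {{≢-nonZero u≢0}}) (decay inv) }
  }
  where
  open ≤-Reasoning
  swap : ∀ p j u → p * (j * u) ≡ j * (p * u)
  swap = solve-∀
  ku′≤ju : k * u′ ≤ j * u
  ku′≤ju = +-cancelʳ-≤ u (k * u′) (j * u) (begin
    k * u′ + u        ≤⟨ +-monoʳ-≤ (k * u′) u≤kx ⟩
    k * u′ + k * x    ≡⟨ *-distribˡ-+ k u′ x ⟨
    k * (u′ + x)      ≤⟨ *-monoʳ-≤ k u′+x≤u ⟩
    u + j * u         ≡⟨ +-comm u (j * u) ⟩
    j * u + u         ∎)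

-- Without any round the bound is 0 ≤ 2kq. After a round `previous` excludes k = 0, so k - 1 is a
-- genuine predecessor.
invariant-ratio : ∀ {k m u n} g → Invariant k m u g → 4 * m ≤ n * n → g ≤[ 2 * k ·ln n ]
invariant-ratio {k} zero    inv 4m≤ q (0≤q , _) = 0≤* (0≤ℕ→ℚ (2 * k)) 0≤q
invariant-ratio {k} {m} {n = n} (suc h) inv 4m≤ with previous inv h refl
... | s≤s {n = j} _ , k^h≤ = ≤·ln-intro n m j h k^h≤ 4m≤

n≤suc[n+n²] : ∀ n → n ≤ suc (n + n * n)
n≤suc[n+n²] n = m≤n⇒m≤1+n (m≤m+n n (n * n))

first : ∀ {n} → 1 ≤ n → ∃ λ (x : Fin n) → toℕ x ≡ 0
first (s≤s _) = zero , refl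

-- Correctness of the greedy program

module _ {n : ℕ} (G : Graph n) (c : Colouring n) {T : Subset n} (sepT : RedBlueSeparating G c T)
         {m L : ℕ} (n≤L : n ≤ L) where

  nonempty : ∀ S → uncovered G c S ≢ 0 → 1 ≤ n
  nonempty S u≢0 = n≢0⇒n>0 λ { refl → u≢0 refl }

  greedyRound-correct : ∀ {s S g} → Represents (memory s) S → uncovered G c S ≢ 0 →
    ∣ S ∣ ≤ g → Invariant ∣ T ∣ m (uncovered G c S) g →
    ∃₂ λ s′ t → Σ[ S′ ∈ Subset n ]
      (encodeInstance G c ⊢ greedyRound , s ⇓ s′ [ t ]) ×
      t ≤ time pick₀ L + (3 + time uncovered₀ L) ×
      Represents (memory s′) S′ × regs s′ 0 ≡ uncovered G c S′ ×
      ∣ S′ ∣ ≤ suc g × Invariant ∣ T ∣ m (uncovered G c S′) (suc g) ×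
      uncovered G c S′ < uncovered G c S
  greedyRound-correct {s} {S} {g} rep u≢0 ∣S∣≤g inv
    with first (nonempty S u≢0)
  ... | x , x≡0
    with pick₀-denotes G c (memory s) rep x x≡0 | compile-correct pick₀ {l = []} {[]} {0} {s} n≤L (holds λ ())
  ... | y , denotes pick≡y , gain≤ | s₁ , _ , run₁ , t₁≤ , v₁ , (_ , mem₁)
    with compile-correct uncovered₀ {l = []} {[]} {0} {⟨ regs s₁ , memory s₁ [ regs s₁ 0 ↦ 1 ] ⟩} n≤L (holds λ ())
  ... | s₃ , _ , run₃ , t₃≤ , v₃ , (_ , mem₃) =
    _ , _ , S [ y ]≔ inside , seq run₁ (seq store run₃) , +-mono-≤ t₁≤ (+-monoʳ-≤ 3 t₃≤) ,
    subst (λ M → Represents M (S [ y ]≔ inside)) (sym mem₃) rep₂ ,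
    trans v₃ (denotation (uncovered₀-denotes G c _ rep₂)) ,
    ≤-trans (∣S[v]≔inside∣≤ S y) (s≤s ∣S∣≤g) ,
    invariant-step u≢0 u≤kx (uncovered-insert G c S y) inv ,
    ≤-trans (≤-reflexive (+-comm 1 _)) (≤-trans (+-monoʳ-≤ _ gain>0) (uncovered-insert G c S y))
    where
    u≤kx : uncovered G c S ≤ ∣ T ∣ * gain G c S y
    u≤kx = uncovered≤ G c sepT S gain≤
    -- If even the largest gain were 0, the covering bound would leave no uncovered pair. This gives
    -- the strict decrease that ends the loop.
    gain>0 : 1 ≤ gain G c S y
    gain>0 = n≢0⇒n>0 λ gain≡0 → u≢0 (n≤0⇒n≡0 (subst (uncovered G c S ≤_)
      (trans (cong (∣ T ∣ *_) gain≡0) (*-zeroʳ ∣ T ∣)) u≤kx))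
    rep₂ : Represents (memory s₁ [ regs s₁ 0 ↦ 1 ]) (S [ y ]≔ inside)
    rep₂ = subst₂ (λ M i → Represents (M [ i ↦ 1 ]) (S [ y ]≔ inside)) (sym mem₁)
             (sym (trans v₁ pick≡y)) (Represents-insert y rep)

  -- `fuel` bounds the remaining pairs, hence the remaining rounds, and so enters the time estimate;
  -- `g` counts the rounds made and bounds the size of the set.
  loop-terminates : ∀ fuel u {s S g} → uncovered G c S ≡ u → u ≤ fuel →
    Represents (memory s) S → regs s 0 ≡ u → ∣ S ∣ ≤ g → Invariant ∣ T ∣ m u g →
    ∃₂ λ s′ t → Σ[ S′ ∈ Subset n ] ∃ λ g′ →
      (encodeInstance G c ⊢ whilenz reg 0 loop greedyRound , s ⇓ s′ [ t ]) ×
      t ≤ fuel * roundTime L + 2 × Represents (memory s′) S′ × uncovered G c S′ ≡ 0 ×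
      ∣ S′ ∣ ≤ g′ × Invariant ∣ T ∣ m 0 g′
  loop-terminates fuel zero {S = S} u≡0 _ rep r ∣S∣≤g inv =
    _ , _ , S , _ , while-zero r , m≤n+m 2 _ , rep , u≡0 , ∣S∣≤g , inv
  loop-terminates (suc fuel) (suc u) {S = S} u≡ (s≤s u≤fuel) rep r ∣S∣≤g inv
    with greedyRound-correct rep (λ u≡0 → 1+n≢0 (trans (sym u≡) u≡0)) ∣S∣≤g
           (subst (λ u → Invariant ∣ T ∣ m u _) (sym u≡) inv)
  ... | s₁ , _ , S₁ , run₁ , t₁≤ , rep₁ , r₁ , ∣S₁∣≤ , inv₁ , u₁<
    with loop-terminates fuel (uncovered G c S₁) refl
           (≤-trans (≤-pred (subst (uncovered G c S₁ <_) u≡ u₁<)) u≤fuel) rep₁ r₁ ∣S₁∣≤ inv₁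
  ... | s₂ , _ , S₂ , g₂ , run₂ , t₂≤ , rest =
    s₂ , _ , S₂ , g₂ , while-nonzero (λ r≡0 → 1+n≢0 (trans (sym r) r≡0)) run₁ run₂ ,
    ≤-trans (+-mono-≤ (+-monoʳ-≤ 2 t₁≤) t₂≤) (≤-reflexive (sym (+-assoc (roundTime L) _ 2))) ,
    rest

Represents-⊥ : ∀ {n} → Represents {n} (λ _ → 0) ⊥
Represents-⊥ = represents λ w → cong bit (sym (Vec.lookup-replicate w false))

proposition4 : Σ[ A ∈ Program ] Σ[ a ∈ ℕ ] Σ[ d ∈ ℕ ]
    ((n : ℕ) → .{{_ : NonZero n}} → (G : Graph n) (c : Colouring n) (twinFree : TwinFree G) →
    Σ[ S ∈ Subset n ] Σ[ t ∈ ℕ ]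
    ( A on encodeInstance G c outputs encodeSubset S inTime t
    × t ≤ a * length (encodeInstance G c) ^ d
    × RedBlueSeparating G c S
    × ∣ S ∣ ≤[ 2 * sepRB G c twinFree ·ln n ] ))
proposition4 = greedy , proj₁ poly-greedyTime , proj₁ (proj₂ poly-greedyTime) , λ n G c twinFree →
  guarantee n G c (smallestSeparating G c twinFree)
  where
  -- Generalised over the optimum, so that matching identifies its value with `∣ T ∣` for an optimal
  -- set T.
  guarantee : ∀ n (G : Graph n) c (opt : ∃ (IsLeast (HasSeparatingSetOfSize G c))) →
    Σ[ S ∈ Subset n ] Σ[ t ∈ ℕ ]
    ( greedy on encodeInstance G c outputs encodeSubset S inTime t
    × t ≤ proj₁ poly-greedyTime * length (encodeInstance G c) ^ proj₁ (proj₂ poly-greedyTime)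
    × RedBlueSeparating G c S
    × ∣ S ∣ ≤[ 2 * proj₁ opt ·ln n ] )
  guarantee n G c (_ , (T , sepT , refl) , _)
    with compile-correct uncovered₀ {encodeInstance G c} {length (encodeInstance G c)} {[]} {[]} {0} {initial}
           n≤L (holds λ ())
    where
    n≤L = subst (n ≤_) (sym (length-encodeInstance G c)) (n≤suc[n+n²] n)
  ... | s₁ , _ , run₁ , t₁≤ , v₁ , (_ , mem₁)
    with loop-terminates G c sepT {uncovered G c ⊥} n≤L L (uncovered G c ⊥) refl u≤L
           (subst (λ M → Represents M ⊥) (sym mem₁) Represents-⊥)
           (trans v₁ (denotation (uncovered₀-denotes G c _ Represents-⊥)))
           ≤-refl (subst (Invariant _ _ _) (sym (Subset.∣⊥∣≡0 n)) (invariant-initial ∣ T ∣ _))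
    where
    L = length (encodeInstance G c)
    n≤L = subst (n ≤_) (sym (length-encodeInstance G c)) (n≤suc[n+n²] n)
    u≤L : uncovered G c ⊥ ≤ L
    u≤L = ≤-trans (≤-trans (m≤n*m _ 4) (4*uncovered≤n² G c ⊥))
            (subst (n * n ≤_) (sym (length-encodeInstance G c)) (m≤n⇒m≤1+n (m≤n+m (n * n) n)))
  ... | s₂ , _ , S , g , run₂ , t₂≤ , rep , u≡0 , ∣S∣≤g , inv =
    S , _ , (s₂ , seq run₁ run₂ , encodeSubset-lookup S (memory s₂) (represented rep)) ,
    ≤-trans (+-mono-≤ t₁≤ t₂≤) (proj₂ (proj₂ poly-greedyTime) _
      (subst (1 ≤_) (sym (length-encodeInstance G c)) (s≤s z≤n))) ,
    uncovered≡0⇒separating G c u≡0 ,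
    λ q n<q → ℚ.≤-trans (ℕ→ℚ-mono-≤ ∣S∣≤g) (invariant-ratio {n = n} g inv (4*uncovered≤n² G c ⊥) q n<q)
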